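{- Let $n\geq 3$ and $k\geq 2$ be integers. Then $$\Phi_k (P_n^2)=\frac{1}{8}\left( k^{n^2} -k^{\lceil \frac{n^2}{2}\rceil} - 2k^{n\lceil\frac{n}{2}\rceil}-2k^{\frac{n(n+1)}{2} } +2k^{\lceil \frac{n}{2}\rceil^2}+2k^{\lceil \frac{n}{2}\rceil \lceil \frac{n+1}{2}\rceil}\right).$$
   Context: $P_n$ is the path on $n$ vertices and $P_n^2=P_n\square P_n$ is the Cartesian product ($V(G\square H)=V(G)\times V(H)$, $(g,h)\sim(g',h')$ iff $g=g'$ and $hh'\in E(H)$, or $gg'\in E(G)$ and $h=h'$), i.e. the $n\times n$ grid. A vertex coloring is distinguishing if the identity is the only automorphism preserving it. Two colorings $c_1,c_2$ of a graph $G$ are equivalent if there is an automorphism $\alpha$ of $G$ with $c_1(v)=c_2(\alpha(v))$ for all $v\in V(G)$. $\Phi_k(G)$ denotes the number of non-equivalent distinguishing vertex colorings of $G$ with colors from $\{1,\ldots,k\}$ (not all colors need be used). -}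

module Defs where

open import Data.Nat.Base using (ℕ; suc)
open import Data.Nat.Properties using (1+n≢n)
open import Data.Fin.Base using (Fin; toℕ)
open import Data.Fin.Permutation using (↔⇒≡)
open import Data.Product.Base using (Σ; _×_; _,_; proj₁; proj₂)
open import Data.Sum.Base using (_⊎_; inj₁; inj₂; swap)
open import Function.Base using (_∘_)
open import Function.Bundles using (_↔_; _⇔_; Inverse; Equivalence; mk⇔)
import Function.Construct.Identity as Identity
import Function.Construct.Symmetry as Symmetry
import Function.Construct.Composition as Composition
open import Level using (0ℓ)
open import Relation.Binary.Bundles using (Setoid)
open import Relation.Binary.PropositionalEquality
  using (_≡_; refl; sym; trans; cong; subst₂; setoid)
open import Relation.Nullary.Negation using (¬_)

record Graph : Set₁ where
  field
    V        : Set
    _∼_      : V → V → Set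
    ∼-sym    : ∀ {u v} → u ∼ v → v ∼ u
    ∼-irrefl : ∀ {v} → ¬ (v ∼ v)

path : ℕ → Graph
path n = record
  { V        = Fin n
  ; _∼_      = λ i j → suc (toℕ i) ≡ toℕ j ⊎ suc (toℕ j) ≡ toℕ i
  ; ∼-sym    = swap
  ; ∼-irrefl = λ { (inj₁ e) → 1+n≢n e ; (inj₂ e) → 1+n≢n e }
  }

infixr 6 _□_

_□_ : Graph → Graph → Graph
G □ H = record
  { V        = G.V × H.V
  ; _∼_      = λ (g , h) (g′ , h′) → (g ≡ g′ × h H.∼ h′) ⊎ (g G.∼ g′ × h ≡ h′)
  ; ∼-sym    = λ { (inj₁ (e , a)) → inj₁ (sym e , H.∼-sym a)
                 ; (inj₂ (a , e)) → inj₂ (G.∼-sym a , sym e) }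
  ; ∼-irrefl = λ { (inj₁ (_ , a)) → H.∼-irrefl a
                 ; (inj₂ (a , _)) → G.∼-irrefl a }
  }
  where
  module G = Graph G
  module H = Graph H

module _ (G : Graph) where
  open Graph G

  record Automorphism : Set where
    field
      bijection : V ↔ V
    open Inverse bijection public using (to; from; strictlyInverseˡ; strictlyInverseʳ)
    field
      preserves : ∀ u v → u ∼ v ⇔ to u ∼ to v

  open Automorphism

  idᴬ : Automorphism
  idᴬ = record
    { bijection = Identity.↔-id V
    ; preserves = λ _ _ → Identity.⇔-id _
    }

  _⁻¹ᴬ : Automorphism → Automorphism
  α ⁻¹ᴬ = record
    { bijection = Symmetry.↔-sym (bijection α)
    ; preserves = λ u v → mk⇔
        (λ a → Equivalence.from (preserves α (from α u) (from α v))
                 (subst₂ _∼_ (sym (strictlyInverseˡ α u)) (sym (strictlyInverseˡ α v)) a))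
        (λ a → subst₂ _∼_ (strictlyInverseˡ α u) (strictlyInverseˡ α v)
                 (Equivalence.to (preserves α (from α u) (from α v)) a))
    }

  -- Diagrammatic order: first α, then β.
  _⨾ᴬ_ : Automorphism → Automorphism → Automorphism
  α ⨾ᴬ β = record
    { bijection = bijection β Composition.↔-∘ bijection α
    ; preserves = λ u v → preserves β (to α u) (to α v) Composition.⇔-∘ preserves α u v
    }

  Coloring : ℕ → Set
  Coloring k = V → Fin k

  module _ {k : ℕ} where

    Distinguishing : Coloring k → Set
    Distinguishing c =
      (α : Automorphism) → (∀ v → c (to α v) ≡ c v) → ∀ v → to α v ≡ v

    Equivalent : Coloring k → Coloring k → Set
    Equivalent c₁ c₂ = Σ Automorphism λ α → ∀ v → c₁ v ≡ c₂ (to α v)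

  -- Distinguishing colorings up to equivalence; the setoid equality ignores
  -- the proof that a coloring is distinguishing.
  DistinguishingColorings : ℕ → Setoid 0ℓ 0ℓ
  DistinguishingColorings k = record
    { Carrier       = Σ (Coloring k) Distinguishing
    ; _≈_           = λ c d → Equivalent (proj₁ c) (proj₁ d)
    ; isEquivalence = record
      { refl  = idᴬ , λ _ → refl
      ; sym   = λ { {c , _} {d , _} (α , e) → (α ⁻¹ᴬ) ,
                    λ v → trans (cong d (sym (strictlyInverseˡ α v))) (sym (e (from α v))) }
      ; trans = λ (α , e) (β , f) → (α ⨾ᴬ β) , λ v → trans (e v) (f (to α v))
      }
    }

-- IsΦ k G m says that Φ_k(G) = m: the setoid of distinguishing colorings of G
-- with k available colors, up to equivalence, has exactly m classes.  Lacking
-- quotients, Φ_k is given by its graph; Φ-unique shows that it is functional.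
IsΦ : ℕ → Graph → ℕ → Set
IsΦ k G m = Inverse (DistinguishingColorings G k) (setoid (Fin m))

Φ-unique : ∀ {k G m m′} → IsΦ k G m → IsΦ k G m′ → m ≡ m′
Φ-unique p q = ↔⇒≡ (Composition.inverse (Symmetry.inverse p) q)

{-# OPTIONS --safe #-}
module Submission where

-- A distinguishing colouring is one with trivial stabilizer in the automorphism group, so the number
-- of classes is the number of such colourings divided by the order of the group.
--
-- An automorphism of the grid permutes the corners, which are the vertices of degree two.  If it fixes
-- a corner and one neighbour of it, then it is the identity, by induction on the distance from that
-- corner: two vertices on an antidiagonal that are corners of a common unit square have only two common
-- neighbours, and one of those is already fixed.  Hence the group is D₄.
--
-- Möbius inversion over the subgroups of D₄ counts the colourings with trivial stabilizer:
-- #trivial = k^(n²) − Σ #⟨reflection or half turn⟩ + 2 #⟨both flips⟩ + 2 #⟨both diagonal reflections⟩,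
-- where #H is the number of colourings invariant under H, that is k^(number of H-orbits on vertices).
-- The orbits are counted by Burnside's lemma.

-- The inversion has so few terms because the Möbius function of the subgroup lattice of D₄, taken
-- from the trivial group, is -1 on the five subgroups of order two, 2 on the two Klein four-groups,
-- and 0 on the cyclic group of order four and on D₄ itself. So only orbits of one or two commuting
-- involutions have to be counted. Φ is defined by an actual bijection with `Fin m`, so every orbit
-- needs a chosen representative. Colourings are therefore coded as numbers below `k ^ N`, where
-- equality is decidable and an orbit has a least element. The parity of `n` enters only through the
-- number c of fixed points of `opposite`. It is kept as an unknown with c² = c, which gives the
-- ceilings in the exponents without a case distinction. In the rigidity argument the border is the
-- obstacle: a border vertex has no two fixed neighbours to be pinned down by. There one uses that
-- all other neighbours of a fixed vertex are already taken.

-- Counting by sums of indicators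

module Counting where
  open import Data.Bool.Base using (if_then_else_)
  open import Data.Nat using (ℕ; zero; suc; _+_; _*_; _≤_; z≤n; s≤s)
  open import Data.Nat.Properties using (+-*-semiring; +-assoc)
  open import Data.Fin.Base using (Fin; zero; suc; _↑ˡ_; _↑ʳ_; combine)
  open import Data.Fin.Permutation using (↔⇒≡)
  open import Data.Product.Base using (Σ; _,_; proj₁; proj₂)
  open import Function.Base using (_∘_)
  open import Function.Bundles using (_⇔_; mk↔ₛ′)
  open import Relation.Nullary using (Dec; yes; no; does; contradiction)
  open import Relation.Nullary.Decidable using (_×-dec_; does-⇔)
  open import Relation.Unary using (Pred; Decidable)
  open import Relation.Binary.PropositionalEquality
  open import Algebra.Properties.Semiring.Sum +-*-semiring public using (sum; ∑-comm; ∑-distrib-+; *-distribˡ-sum; *-distribʳ-sum; sum-cong-≗; sum-permute)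
  open ≡-Reasoning

  ⟦_⟧ : ∀ {p} {P : Set p} → Dec P → ℕ
  ⟦ d ⟧ = if does d then 1 else 0

  ⟦⟧-cong : ∀ {p q} {P : Set p} {Q : Set q} → P ⇔ Q → (d : Dec P) (e : Dec Q) → ⟦ d ⟧ ≡ ⟦ e ⟧
  ⟦⟧-cong P⇔Q d e = cong (if_then 1 else 0) (does-⇔ P⇔Q d e)

  ⟦×-dec⟧ : ∀ {p q} {P : Set p} {Q : Set q} (d : Dec P) (e : Dec Q) → ⟦ d ×-dec e ⟧ ≡ ⟦ d ⟧ * ⟦ e ⟧
  ⟦×-dec⟧ (no _)  e       = refl
  ⟦×-dec⟧ (yes _) (no _)  = refl
  ⟦×-dec⟧ (yes _) (yes _) = refl

  sum-const : ∀ n c → sum {n} (λ _ → c) ≡ n * c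
  sum-const zero    c = refl
  sum-const (suc n) c = cong (c +_) (sum-const n c)

  sum-+ : ∀ m {n} (f : Fin (m + n) → ℕ) → sum f ≡ sum (λ i → f (i ↑ˡ n)) + sum (λ j → f (m ↑ʳ j))
  sum-+ zero    f = refl
  sum-+ (suc m) f = trans (cong (f zero +_) (sum-+ m (f ∘ suc))) (sym (+-assoc (f zero) _ _))

  sum-* : ∀ m {n} (f : Fin (m * n) → ℕ) → sum f ≡ sum {m} (λ i → sum {n} (λ j → f (combine i j)))
  sum-* zero        f = refl
  sum-* (suc m) {n} f = trans (sum-+ n f) (cong (sum (λ j → f (j ↑ˡ (m * n))) +_) (sum-* m {n} (f ∘ (n ↑ʳ_))))

  sum-product : ∀ {m n} (f : Fin m → ℕ) (g : Fin n → ℕ) → sum (λ i → sum (λ j → f i * g j)) ≡ sum f * sum g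
  sum-product f g = begin
    sum (λ i → sum (λ j → f i * g j)) ≡⟨ sum-cong-≗ (λ i → *-distribˡ-sum (f i) g) ⟨
    sum (λ i → f i * sum g)           ≡⟨ *-distribʳ-sum (sum g) f ⟨
    sum f * sum g                     ∎

  count : ∀ {N p} {P : Pred (Fin N) p} → Decidable P → ℕ
  count P? = sum (λ i → ⟦ P? i ⟧)

  count-cong : ∀ {N p q} {P : Pred (Fin N) p} {Q : Pred (Fin N) q} (P? : Decidable P) (Q? : Decidable Q) →
               (∀ i → P i ⇔ Q i) → count P? ≡ count Q?
  count-cong P? Q? P⇔Q = sum-cong-≗ (λ i → ⟦⟧-cong (P⇔Q i) (P? i) (Q? i))

  nth : ∀ {N p} {P : Pred (Fin N) p} (P? : Decidable P) → Fin (count P?) → Σ (Fin N) P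
  nth {suc N} P? j with P? zero
  nth {suc N} P? zero    | yes p = zero , p
  nth {suc N} P? (suc j) | yes p = let i , q = nth (P? ∘ suc) j in suc i , q
  nth {suc N} P? j       | no _  = let i , q = nth (P? ∘ suc) j in suc i , q

  rank : ∀ {N p} {P : Pred (Fin N) p} (P? : Decidable P) → (i : Fin N) → P i → Fin (count P?)
  rank {suc N} P? i p with P? zero
  rank {suc N} P? zero    p | yes _ = zero
  rank {suc N} P? zero    p | no ¬p = contradiction p ¬p
  rank {suc N} P? (suc i) p | yes _ = suc (rank (P? ∘ suc) i p)
  rank {suc N} P? (suc i) p | no _  = rank (P? ∘ suc) i p

  nth-rank : ∀ {N p} {P : Pred (Fin N) p} (P? : Decidable P) i (p : P i) → proj₁ (nth P? (rank P? i p)) ≡ i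
  nth-rank {suc N} P? i p with P? zero
  nth-rank {suc N} P? zero    p | yes _ = refl
  nth-rank {suc N} P? zero    p | no ¬p = contradiction p ¬p
  nth-rank {suc N} P? (suc i) p | yes _ = cong suc (nth-rank (P? ∘ suc) i p)
  nth-rank {suc N} P? (suc i) p | no _  = cong suc (nth-rank (P? ∘ suc) i p)

  -- The proof `q` and the index `i` are arbitrary, so that the lemma applies to predicates with
  -- many proofs.
  rank-nth : ∀ {N p} {P : Pred (Fin N) p} (P? : Decidable P) j {i} (q : P i) → proj₁ (nth P? j) ≡ i → rank P? i q ≡ j
  rank-nth {suc N} P? j q e with P? zero
  rank-nth {suc N} P? zero    q refl | yes _ = refl
  rank-nth {suc N} P? (suc j) q refl | yes _ = cong suc (rank-nth (P? ∘ suc) j q refl)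
  rank-nth {suc N} P? j       q refl | no _  = rank-nth (P? ∘ suc) j q refl

  -- `nth` and `rank` turn the subset into `Fin (count P?)`, and finite types in bijection have
  -- equal size. Since `f` is total and is inverted on `P` alone, no subtype appears.
  count-bijection : ∀ {N M p} {P : Pred (Fin N) p} (P? : Decidable P) (f : Fin N → Fin M) (g : Fin M → Fin N) →
                    (∀ j → P (g j)) → (∀ j → f (g j) ≡ j) → (∀ i → P i → g (f i) ≡ i) → count P? ≡ M
  count-bijection P? f g g-P f∘g g∘f = ↔⇒≡ (mk↔ₛ′
    (λ j → f (proj₁ (nth P? j)))
    (λ y → rank P? (g y) (g-P y))
    (λ y → trans (cong f (nth-rank P? (g y) (g-P y))) (f∘g y))
    (λ j → rank-nth P? j _ (sym (g∘f (proj₁ (nth P? j)) (proj₂ (nth P? j))))))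

  count-singleton : ∀ {N p} {P : Pred (Fin N) p} (P? : Decidable P) i → P i → (∀ j → P j → j ≡ i) → count P? ≡ 1
  count-singleton P? i p unique = count-bijection P? (λ _ → zero) (λ _ → i) (λ _ → p) (λ { zero → refl }) (λ j q → sym (unique j q))

  -- Two positions in the enumeration of the subset name the same element and hence coincide.
  count-subsingleton : ∀ {N p} {P : Pred (Fin N) p} (P? : Decidable P) → (∀ i j → P i → P j → i ≡ j) → count P? ≤ 1
  count-subsingleton P? unique = at-most-one λ a b → trans
    (sym (rank-nth P? a (proj₂ (nth P? a)) refl))
    (rank-nth P? b (proj₂ (nth P? a)) (unique _ _ (proj₂ (nth P? b)) (proj₂ (nth P? a))))
    where
    at-most-one : ∀ {m} → (∀ (a b : Fin m) → a ≡ b) → m ≤ 1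
    at-most-one {zero}        _ = z≤n
    at-most-one {suc zero}    _ = s≤s z≤n
    at-most-one {suc (suc m)} f with () ← f zero (suc zero)

-- Colourings coded as numbers

module Coding where
  open import Data.Nat using (ℕ; suc; _^_)
  open import Data.Fin.Base using (Fin; zero; suc; combine; finToFun; funToFin)
  open import Data.Fin.Properties using (finToFun-funToFin; funToFin-finToFin)
  open import Function.Base using (_∘_)
  open import Relation.Binary.PropositionalEquality

  module _ {k N : ℕ} where

    colour : Fin (k ^ N) → Fin N → Fin k
    colour = finToFun

    code : (Fin N → Fin k) → Fin (k ^ N)
    code = funToFin

    colour-code : ∀ c → colour (code c) ≗ c
    colour-code = finToFun-funToFin

    code-colour : ∀ x → code (colour x) ≡ x
    code-colour = funToFin-finToFin {N} {k}

  code-cong : ∀ {k N} {c d : Fin N → Fin k} → c ≗ d → code c ≡ code d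
  code-cong {N = ℕ.zero} e = refl
  code-cong {N = suc N}  e = cong₂ combine (e zero) (code-cong (e ∘ suc))

  -- Stands in for function extensionality: on codes, fixed points and orbits can be expressed with
  -- `≡`.
  colour-injective : ∀ k N {x y : Fin (k ^ N)} → (∀ v → colour {k} {N} x v ≡ colour {k} {N} y v) → x ≡ y
  colour-injective k N {x} {y} e = begin
    x                        ≡⟨ code-colour {k} {N} x ⟨
    code (colour {k} {N} x)  ≡⟨ code-cong e ⟩
    code (colour {k} {N} y)  ≡⟨ code-colour {k} {N} y ⟩
    y                        ∎
    where open ≡-Reasoning

-- Finite group actions, orbits and free points

module Actions where
  open Counting
  open Coding
  open import Data.Nat using (ℕ; _*_; _^_)
  open import Data.Nat.Properties using (*-identityˡ)
  open import Data.Fin.Base using (Fin; _≤_)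
  open import Data.Fin.Properties using (_≟_; all?; ≤-totalOrder; ≤-antisym)
  open import Data.Fin.Permutation using (Permutation)
  open import Data.List.Base using (tabulate)
  open import Data.List.Relation.Unary.All.Properties using (tabulate⁻)
  open import Data.Product.Base using (_×_; _,_; proj₁; proj₂)
  open import Function.Base using (_∘_)
  open import Function.Bundles using (_↔_; _⇔_; Inverse; Equivalence; mk⇔; mk↔ₛ′)
  open import Function.Construct.Composition using (_↔-∘_)
  open import Function.Construct.Symmetry using (↔-sym)
  open import Relation.Nullary using (Dec; yes; no)
  open import Relation.Nullary.Decidable using (map′; _→-dec_; _×-dec_)
  open import Relation.Unary using (Pred; Decidable)
  open import Relation.Binary.PropositionalEquality
  open ≡-Reasoning

  record FiniteGroup : Set₁ where
    infixl 7 _∙_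
    infix  8 _⁻¹
    field
      Carrier     : Set
      _∙_         : Carrier → Carrier → Carrier
      ε           : Carrier
      _⁻¹         : Carrier → Carrier
      assoc       : ∀ x y z → (x ∙ y) ∙ z ≡ x ∙ (y ∙ z)
      identityˡ   : ∀ x → ε ∙ x ≡ x
      inverseˡ    : ∀ x → x ⁻¹ ∙ x ≡ ε
      inverseʳ    : ∀ x → x ∙ x ⁻¹ ≡ ε
      order       : ℕ
      enumeration : Fin order ↔ Carrier

    open Inverse enumeration public renaming (to to element; from to index) using (strictlyInverseˡ; strictlyInverseʳ)

    identityʳ : ∀ x → x ∙ ε ≡ x
    identityʳ x = begin
      x ∙ ε           ≡⟨ cong (x ∙_) (inverseˡ x) ⟨
      x ∙ (x ⁻¹ ∙ x)  ≡⟨ assoc x (x ⁻¹) x ⟨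
      x ∙ x ⁻¹ ∙ x    ≡⟨ cong (_∙ x) (inverseʳ x) ⟩
      ε ∙ x           ≡⟨ identityˡ x ⟩
      x               ∎

    -- Left multiplication read on indices, as needed to reindex sums over the group.
    translation : Carrier → Permutation order order
    translation g = ↔-sym enumeration ↔-∘ (mk↔ₛ′ (g ∙_) (g ⁻¹ ∙_) (cancel (inverseʳ g)) (cancel (inverseˡ g)) ↔-∘ enumeration)
      where
      cancel : ∀ {a b} → a ∙ b ≡ ε → ∀ x → a ∙ (b ∙ x) ≡ x
      cancel {a} {b} e x = trans (sym (assoc a b x)) (trans (cong (_∙ x) e) (identityˡ x))

    element-translation : ∀ g i → element (Inverse.to (translation g) i) ≡ g ∙ element i
    element-translation g i = strictlyInverseˡ (g ∙ element i)

  record Action (G : FiniteGroup) (N : ℕ) : Set where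
    open FiniteGroup G
    field
      act   : Carrier → Fin N → Fin N
      act-ε : ∀ x → act ε x ≡ x
      act-∙ : ∀ g h x → act (g ∙ h) x ≡ act g (act h x)

    act-inverseˡ : ∀ g x → act (g ⁻¹) (act g x) ≡ x
    act-inverseˡ g x = trans (sym (act-∙ _ _ x)) (trans (cong (λ h → act h x) (inverseˡ g)) (act-ε x))

    act-inverseʳ : ∀ g x → act g (act (g ⁻¹) x) ≡ x
    act-inverseʳ g x = trans (sym (act-∙ _ _ x)) (trans (cong (λ h → act h x) (inverseʳ g)) (act-ε x))

    open import Data.List.Extrema (≤-totalOrder N) using (argmin; f[argmin]≤f[xs])

    abstract
      -- The least point of an orbit is its canonical representative. An element leading there is
      -- kept as well, since cosets of stabilizers and equivalences of colourings are built from it.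
      -- `ε` is the starting value of `argmin`.
      minimizer : Fin N → Carrier
      minimizer x = argmin (λ g → act g x) ε (tabulate element)

      canon : Fin N → Fin N
      canon x = act (minimizer x) x

      canon-minimizer : ∀ x → canon x ≡ act (minimizer x) x
      canon-minimizer x = refl

      canon-minimal : ∀ g x → canon x ≤ act g x
      canon-minimal g x = subst (λ h → canon x ≤ act h x) (strictlyInverseˡ g)
        (tabulate⁻ (f[argmin]≤f[xs] {f = λ g → act g x} ε (tabulate element)) (index g))

    -- The points `x` and `act g x` have the same translates, so each minimum bounds the other.
    canon-act : ∀ g x → canon (act g x) ≡ canon x
    canon-act g x = ≤-antisym
      (subst (canon (act g x) ≤_) step (canon-minimal (minimizer x ∙ g ⁻¹) (act g x)))
      (subst (canon x ≤_) (trans (act-∙ _ g x) (sym (canon-minimizer (act g x)))) (canon-minimal (minimizer (act g x) ∙ g) x))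
      where
      step : act (minimizer x ∙ g ⁻¹) (act g x) ≡ canon x
      step = trans (act-∙ _ _ _) (trans (cong (act (minimizer x)) (act-inverseˡ g x)) (sym (canon-minimizer x)))

    canon-idem : ∀ x → canon (canon x) ≡ canon x
    canon-idem x = trans (cong canon (canon-minimizer x)) (canon-act (minimizer x) x)

    Canonical? : Decidable (λ x → canon x ≡ x)
    Canonical? x = canon x ≟ x

    orbits : ℕ
    orbits = count Canonical?

    fixed : Carrier → ℕ
    fixed g = count (λ x → act g x ≟ x)

    stabilizer : Fin N → ℕ
    stabilizer x = count (λ i → act (element i) x ≟ x)

    act-permutation : Carrier → Permutation N N
    act-permutation g = mk↔ₛ′ (act g) (act (g ⁻¹)) (act-inverseʳ g) (act-inverseˡ g)

    -- The elements taking x to canon x = act m x form the coset of the stabilizer by m.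
    stabilizer-canonical : ∀ x → stabilizer x ≡ count (λ i → Canonical? (act (element i) x))
    stabilizer-canonical x = begin
      count (λ i → act (element i) x ≟ x)
        ≡⟨ count-cong (λ i → act (element i) x ≟ x) (λ i → Canonical? (act (element (π i)) x)) moved ⟩
      count (λ i → Canonical? (act (element (π i)) x))
        ≡⟨ sum-permute (λ i → ⟦ Canonical? (act (element i) x) ⟧) (translation m) ⟨
      count (λ i → Canonical? (act (element i) x))        ∎
      where
      m = minimizer x
      π = Inverse.to (translation m)

      act-π : ∀ i → act (element (π i)) x ≡ act m (act (element i) x)
      act-π i = trans (cong (λ g → act g x) (element-translation m i)) (act-∙ m _ x)

      moved : ∀ i → act (element i) x ≡ x ⇔ canon (act (element (π i)) x) ≡ act (element (π i)) x
      moved i = mk⇔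
        (λ e → trans (canon-act _ x) (sym (trans (act-π i) (trans (cong (act m) e) (sym (canon-minimizer x))))))
        (λ e → begin
          act (element i) x                           ≡⟨ act-inverseˡ m _ ⟨
          act (m ⁻¹) (act m (act (element i) x))      ≡⟨ cong (act (m ⁻¹)) (act-π i) ⟨
          act (m ⁻¹) (act (element (π i)) x)          ≡⟨ cong (act (m ⁻¹)) e ⟨
          act (m ⁻¹) (canon (act (element (π i)) x))  ≡⟨ cong (act (m ⁻¹)) (canon-act _ x) ⟩
          act (m ⁻¹) (canon x)                        ≡⟨ cong (act (m ⁻¹)) (canon-minimizer x) ⟩
          act (m ⁻¹) (act m x)                        ≡⟨ act-inverseˡ m x ⟩
          x                                           ∎)

    -- The orbit-stabilizer theorem in summed form. Once the stabilizer is rewritten as the number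
    -- of elements taking `x` to the canonical point, the sums are exchanged; each group element
    -- permutes the points and preserves `w`, so all inner sums agree. Weight 1 gives Burnside's
    -- lemma, the indicator of `Free` gives the number of free orbits.
    weighted-orbit-count : (w : Fin N → ℕ) → (∀ g x → w (act g x) ≡ w x) →
                           sum (λ x → w x * stabilizer x) ≡ order * sum (λ x → w x * ⟦ Canonical? x ⟧)
    weighted-orbit-count w w-act = begin
      sum (λ x → w x * stabilizer x)
        ≡⟨ sum-cong-≗ (λ x → trans (cong (w x *_) (stabilizer-canonical x)) (*-distribˡ-sum (w x) (λ i → ⟦ Canonical? (act (element i) x) ⟧))) ⟩
      sum (λ x → sum (λ i → w x * ⟦ Canonical? (act (element i) x) ⟧))
        ≡⟨ ∑-comm (λ x i → w x * ⟦ Canonical? (act (element i) x) ⟧) ⟩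
      sum (λ i → sum (λ x → w x * ⟦ Canonical? (act (element i) x) ⟧))
        ≡⟨ sum-cong-≗ (λ i → sum-cong-≗ (λ x → cong (_* ⟦ Canonical? (act (element i) x) ⟧) (sym (w-act (element i) x)))) ⟩
      sum (λ i → sum (λ x → weight (act (element i) x)))
        ≡⟨ sum-cong-≗ (λ i → sum-permute weight (act-permutation (element i))) ⟨
      sum {order} (λ _ → sum weight)
        ≡⟨ sum-const order (sum weight) ⟩
      order * sum weight
        ∎
      where
      weight : Fin N → ℕ
      weight x = w x * ⟦ Canonical? x ⟧

    burnside : sum (λ i → fixed (element i)) ≡ order * orbits
    burnside = begin
      sum (λ i → fixed (element i))             ≡⟨ ∑-comm (λ i x → ⟦ act (element i) x ≟ x ⟧) ⟩
      sum stabilizer                            ≡⟨ sum-cong-≗ (λ x → *-identityˡ (stabilizer x)) ⟨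
      sum (λ x → 1 * stabilizer x)              ≡⟨ weighted-orbit-count (λ _ → 1) (λ _ _ → refl) ⟩
      order * sum (λ x → 1 * ⟦ Canonical? x ⟧)
        ≡⟨ cong (order *_) (sum-cong-≗ (λ x → *-identityˡ ⟦ Canonical? x ⟧)) ⟩
      order * orbits                            ∎

    Free : Fin N → Set
    Free x = ∀ g → act g x ≡ x → g ≡ ε

    abstract
      Free? : Decidable Free
      Free? x = map′ (λ f g e → element-injective (f (index g) (trans (cong (λ h → act h x) (strictlyInverseˡ g)) e)))
                     (λ f i e → trans (sym (strictlyInverseʳ i)) (cong index (f (element i) e)))
                     (all? (λ i → (act (element i) x ≟ x) →-dec (i ≟ index ε)))
        where
        element-injective : ∀ {g} → index g ≡ index ε → g ≡ ε
        element-injective {g} e = trans (sym (strictlyInverseˡ g)) (trans (cong element e) (strictlyInverseˡ ε))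

    -- Stabilizers along an orbit are conjugate: if `h` fixes `act g x`, then `g ⁻¹ ∙ (h ∙ g)` fixes
    -- `x` and is trivial, and `h` is recovered by conjugating back.
    Free-act : ∀ g {x} → Free x → Free (act g x)
    Free-act g {x} free h e = begin
      h                          ≡⟨ identityʳ h ⟨
      h ∙ ε                      ≡⟨ cong (h ∙_) (inverseʳ g) ⟨
      h ∙ (g ∙ g ⁻¹)             ≡⟨ assoc h g (g ⁻¹) ⟨
      h ∙ g ∙ g ⁻¹               ≡⟨ cong (_∙ g ⁻¹) (identityˡ (h ∙ g)) ⟨
      ε ∙ (h ∙ g) ∙ g ⁻¹         ≡⟨ cong (λ k → k ∙ (h ∙ g) ∙ g ⁻¹) (inverseʳ g) ⟨
      g ∙ g ⁻¹ ∙ (h ∙ g) ∙ g ⁻¹  ≡⟨ cong (_∙ g ⁻¹) (assoc g (g ⁻¹) (h ∙ g)) ⟩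
      g ∙ (g ⁻¹ ∙ (h ∙ g)) ∙ g ⁻¹ ≡⟨ cong (λ k → g ∙ k ∙ g ⁻¹) (free _ (begin
        act (g ⁻¹ ∙ (h ∙ g)) x      ≡⟨ act-∙ _ _ x ⟩
        act (g ⁻¹) (act (h ∙ g) x)  ≡⟨ cong (act (g ⁻¹)) (act-∙ h g x) ⟩
        act (g ⁻¹) (act h (act g x)) ≡⟨ cong (act (g ⁻¹)) e ⟩
        act (g ⁻¹) (act g x)        ≡⟨ act-inverseˡ g x ⟩
        x                           ∎)) ⟩
      g ∙ ε ∙ g ⁻¹               ≡⟨ cong (_∙ g ⁻¹) (identityʳ g) ⟩
      g ∙ g ⁻¹                   ≡⟨ inverseʳ g ⟩
      ε                          ∎

    Free-act⇔ : ∀ g x → Free (act g x) ⇔ Free x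
    Free-act⇔ g x = mk⇔ (λ f → subst Free (act-inverseˡ g x) (Free-act (g ⁻¹) f)) (Free-act g)

    Free⇒stabilizer≡1 : ∀ {x} → Free x → stabilizer x ≡ 1
    Free⇒stabilizer≡1 {x} free = count-singleton (λ i → act (element i) x ≟ x) (index ε)
      (trans (cong (λ g → act g x) (strictlyInverseˡ ε)) (act-ε x))
      (λ i e → trans (sym (strictlyInverseʳ i)) (cong index (free (element i) e)))

    Representative? : Decidable (λ x → Free x × canon x ≡ x)
    Representative? x = Free? x ×-dec Canonical? x

    canon-representative : ∀ x → Free x → Free (canon x) × canon (canon x) ≡ canon x
    canon-representative x free = subst Free (sym (canon-minimizer x)) (Free-act (minimizer x) free) , canon-idem x

    abstract
      freeOrbits : ℕ
      freeOrbits = count Representative?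

      freeOrbit : ∀ x → Free x → Fin freeOrbits
      freeOrbit x free = rank Representative? (canon x) (canon-representative x free)

      representative : Fin freeOrbits → Fin N
      representative j = proj₁ (nth Representative? j)

      representative-free : ∀ j → Free (representative j)
      representative-free j = proj₁ (proj₂ (nth Representative? j))

      -- The freeness proof is arbitrary, so the class depends on the orbit alone, as a map out of a
      -- setoid requires.
      freeOrbit-unique : ∀ j x free g → act g x ≡ representative j → freeOrbit x free ≡ j
      freeOrbit-unique j x free g e = rank-nth Representative? j (canon-representative x free) (begin
        representative j          ≡⟨ proj₂ (proj₂ (nth Representative? j)) ⟨
        canon (representative j)  ≡⟨ cong canon e ⟨
        canon (act g x)           ≡⟨ canon-act g x ⟩
        canon x                   ∎)

      representative-freeOrbit : ∀ x free → act (minimizer x) x ≡ representative (freeOrbit x free)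
      representative-freeOrbit x free = trans (sym (canon-minimizer x))
        (sym (nth-rank Representative? (canon x) (canon-representative x free)))

      -- On free points the stabilizer has size 1, so weighting by freeness counts the free points
      -- on one side and `order` times the canonical ones on the other.
      free-orbit-count : count Free? ≡ order * freeOrbits
      free-orbit-count = begin
        count Free?                                       ≡⟨ sum-cong-≗ (λ x → pointwise (Free? x)) ⟨
        sum (λ x → ⟦ Free? x ⟧ * stabilizer x)
          ≡⟨ weighted-orbit-count (λ x → ⟦ Free? x ⟧) (λ g x → ⟦⟧-cong (Free-act⇔ g x) (Free? _) (Free? x)) ⟩
        order * sum (λ x → ⟦ Free? x ⟧ * ⟦ Canonical? x ⟧)
          ≡⟨ cong (order *_) (sum-cong-≗ (λ x → ⟦×-dec⟧ (Free? x) (Canonical? x))) ⟨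
        order * freeOrbits  ∎
        where
        pointwise : ∀ {x} (free? : Dec (Free x)) → ⟦ free? ⟧ * stabilizer x ≡ ⟦ free? ⟧
        pointwise (yes free) = trans (*-identityˡ _) (Free⇒stabilizer≡1 free)
        pointwise (no _)     = refl

    -- An invariant colouring is a colouring of the set of orbits: one direction restricts along
    -- `section` to canonical points, the other pulls back along `quotient`.
    count-invariant-colourings : ∀ {k p} {P : Pred (Fin (k ^ N)) p} (P? : Decidable P) →
                                 (∀ c → P c ⇔ (∀ g v → colour c (act g v) ≡ colour c v)) → count P? ≡ k ^ orbits
    count-invariant-colourings {k} P? P⇔ = count-bijection P?
      (λ c → code (colour c ∘ section))
      (λ d → code (colour d ∘ quotient))
      (λ d → Equivalence.from (P⇔ _) (λ g v → begin
        colour (code (colour d ∘ quotient)) (act g v)  ≡⟨ colour-code (colour d ∘ quotient) _ ⟩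
        colour d (quotient (act g v))
          ≡⟨ cong (colour d) (rank-nth Canonical? (quotient v) _ (trans (nth-quotient v) (sym (canon-act g v)))) ⟩
        colour d (quotient v)                          ≡⟨ colour-code (colour d ∘ quotient) v ⟨
        colour (code (colour d ∘ quotient)) v          ∎))
      (λ d → colour-injective k orbits (λ j → begin
        colour (code (colour (code (colour d ∘ quotient)) ∘ section)) j
          ≡⟨ colour-code (colour (code (colour d ∘ quotient)) ∘ section) j ⟩
        colour (code (colour d ∘ quotient)) (section j)
          ≡⟨ colour-code (colour d ∘ quotient) _ ⟩
        colour d (quotient (section j))
          ≡⟨ cong (colour d) (rank-nth Canonical? j _ (sym (proj₂ (nth Canonical? j)))) ⟩
        colour d j                                                       ∎))
      (λ c p → colour-injective k N (λ v → begin
        colour (code (colour (code (colour c ∘ section)) ∘ quotient)) v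
          ≡⟨ colour-code (colour (code (colour c ∘ section)) ∘ quotient) v ⟩
        colour (code (colour c ∘ section)) (quotient v)                  ≡⟨ colour-code (colour c ∘ section) _ ⟩
        colour c (section (quotient v))                                  ≡⟨ cong (colour c) (nth-quotient v) ⟩
        colour c (canon v)
          ≡⟨ cong (colour c) (canon-minimizer v) ⟩
        colour c (act (minimizer v) v)
          ≡⟨ Equivalence.to (P⇔ c) p (minimizer v) v ⟩
        colour c v                                                       ∎))
      where
      section : Fin orbits → Fin N
      section j = proj₁ (nth Canonical? j)

      quotient : Fin N → Fin orbits
      quotient v = rank Canonical? (canon v) (canon-idem v)

      nth-quotient : ∀ v → section (quotient v) ≡ canon v
      nth-quotient v = nth-rank Canonical? (canon v) (canon-idem v)

  -- Precomposition reverses the order of factors; the inverse restores it and makes this a left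
  -- action.
  colouringAction : ∀ {G N} → Action G N → ∀ k → Action G (k ^ N)
  colouringAction {G} {N} A k = record
    { act   = λ g c → code (colour c ∘ act (g ⁻¹))
    ; act-ε = λ c → colour-injective k N (λ v → trans (colour-code (colour c ∘ act (ε ⁻¹)) v) (cong (colour c) (begin
        act (ε ⁻¹) v          ≡⟨ cong (act (ε ⁻¹)) (act-ε v) ⟨
        act (ε ⁻¹) (act ε v)  ≡⟨ act-inverseˡ ε v ⟩
        v                     ∎)))
    ; act-∙ = λ g h c → code-cong (λ v → trans (cong (colour c) (contravariant g h v))
                (sym (colour-code (colour c ∘ act (h ⁻¹)) (act (g ⁻¹) v))))
    }
    where
    open FiniteGroup G
    open Action A
    -- Cancelling moves by `g` and `h` are inserted until `(g ∙ h) ⁻¹` meets `g ∙ h`.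
    contravariant : ∀ g h v → act ((g ∙ h) ⁻¹) v ≡ act (h ⁻¹) (act (g ⁻¹) v)
    contravariant g h v = begin
      act ((g ∙ h) ⁻¹) v ≡⟨ cong (act ((g ∙ h) ⁻¹)) (act-inverseʳ g v) ⟨
      act ((g ∙ h) ⁻¹) (act g (act (g ⁻¹) v)) ≡⟨ cong (act ((g ∙ h) ⁻¹) ∘ act g) (act-inverseʳ h _) ⟨
      act ((g ∙ h) ⁻¹) (act g (act h (act (h ⁻¹) (act (g ⁻¹) v)))) ≡⟨ cong (act ((g ∙ h) ⁻¹)) (act-∙ g h _) ⟨
      act ((g ∙ h) ⁻¹) (act (g ∙ h) (act (h ⁻¹) (act (g ⁻¹) v))) ≡⟨ act-inverseˡ (g ∙ h) _ ⟩
      act (h ⁻¹) (act (g ⁻¹) v) ∎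

  module _ {G N} (A : Action G N) (k : ℕ) where
    open FiniteGroup G
    open Action A
    private module C = Action (colouringAction A k)

    colour-act : ∀ g c v → colour (C.act g c) (act g v) ≡ colour {k} {N} c v
    colour-act g c v = trans (colour-code (colour c ∘ act (g ⁻¹)) _) (cong (colour c) (act-inverseˡ g v))

    -- Moving the group element to the other side leaves no inverse behind. With `d` equal to `c`
    -- this is invariance under `g`; in general it is the condition in `Equivalent`.
    act≡⇔ : ∀ g c d → C.act g c ≡ d ⇔ (∀ v → colour {k} {N} d (act g v) ≡ colour c v)
    act≡⇔ g c d = mk⇔
      (λ { refl v → colour-act g c v })
      (λ e → colour-injective k N (λ v → begin
        colour (C.act g c) v       ≡⟨ colour-code (colour c ∘ act (g ⁻¹)) v ⟩
        colour c (act (g ⁻¹) v)    ≡⟨ e (act (g ⁻¹) v) ⟨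
        colour d (act g (act (g ⁻¹) v)) ≡⟨ cong (colour d) (act-inverseʳ g v) ⟩
        colour d v                 ∎))

-- Orbits of one or two commuting involutions

module KleinActions where
  open Counting
  open Coding
  open Actions
  open import Data.Bool.Base using (Bool; true; false; _xor_)
  open import Data.Bool.Properties using (xor-assoc; xor-same)
  open import Data.Nat using (ℕ; _+_; _*_; _^_)
  open import Data.Nat.Properties using (*-cancelˡ-≡; *-assoc)
  open import Data.Nat.Tactic.RingSolver using (solve-∀)
  open import Data.Fin.Base using (Fin)
  open import Data.Fin.Properties using (_≟_; 2↔Bool; *↔×)
  open import Data.Product.Base using (_×_; _,_)
  open import Data.Product.Function.NonDependent.Propositional using (_×-↔_; _×-⇔_)
  open import Relation.Nullary.Decidable using (_×-dec_)
  open import Function.Base using (_∘_; id)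
  open import Function.Bundles using (_↔_; _⇔_; Equivalence; mk⇔)
  open import Function.Construct.Composition using (_⇔-∘_; _↔-∘_)
  open import Relation.Unary using (Pred; Decidable)
  open import Relation.Binary.PropositionalEquality
  open ≡-Reasoning

  ×-enumeration : ∀ {m n} {A B : Set} → Fin m ↔ A → Fin n ↔ B → Fin (m * n) ↔ (A × B)
  ×-enumeration A B = (A ×-↔ B) ↔-∘ *↔×

  Klein : FiniteGroup
  Klein = record
    { Carrier     = Bool × Bool
    ; _∙_         = λ (p , q) (p′ , q′) → p xor p′ , q xor q′
    ; ε           = false , false
    ; _⁻¹         = id
    ; assoc       = λ (p , q) (p′ , q′) (p″ , q″) → cong₂ _,_ (xor-assoc p p′ p″) (xor-assoc q q′ q″)
    ; identityˡ   = λ _ → refl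
    ; inverseˡ    = λ (p , q) → cong₂ _,_ (xor-same p) (xor-same q)
    ; inverseʳ    = λ (p , q) → cong₂ _,_ (xor-same p) (xor-same q)
    ; order       = 4
    ; enumeration = ×-enumeration 2↔Bool 2↔Bool
    }

  _^ᵇ_ : ∀ {A : Set} → (A → A) → Bool → A → A
  f ^ᵇ false = id
  f ^ᵇ true  = f

  module _ {A : Set} where

    ^ᵇ-xor : ∀ {f : A → A} → (∀ x → f (f x) ≡ x) → ∀ p q x → (f ^ᵇ (p xor q)) x ≡ (f ^ᵇ p) ((f ^ᵇ q) x)
    ^ᵇ-xor invol false q     x = refl
    ^ᵇ-xor invol true  false x = refl
    ^ᵇ-xor invol true  true  x = sym (invol x)

    ^ᵇ-comm : ∀ {f g : A → A} → (∀ x → f (g x) ≡ g (f x)) → ∀ p q x → (f ^ᵇ p) ((g ^ᵇ q) x) ≡ (g ^ᵇ q) ((f ^ᵇ p) x)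
    ^ᵇ-comm comm false q     x = refl
    ^ᵇ-comm comm true  false x = refl
    ^ᵇ-comm comm true  true  x = comm x

  #fixed : ∀ {N} → (Fin N → Fin N) → ℕ
  #fixed f = count (λ x → f x ≟ x)

  #fixed-id : ∀ N → #fixed {N} id ≡ N
  #fixed-id N = count-bijection (λ x → x ≟ x) id id (λ _ → refl) (λ _ → refl) (λ _ _ → refl)

  module _ {N} (a b : Fin N → Fin N) (a² : ∀ x → a (a x) ≡ x) (b² : ∀ x → b (b x) ≡ x)
           (ab≡ba : ∀ x → a (b x) ≡ b (a x)) where

    -- `a` and `b` may coincide or be the identity: Burnside's lemma counts the orbits whether or
    -- not the action is faithful.
    kleinAction : Action Klein N
    kleinAction = record
      { act   = λ (p , q) x → (a ^ᵇ p) ((b ^ᵇ q) x)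
      ; act-ε = λ _ → refl
      ; act-∙ = λ (p , q) (p′ , q′) x → begin
          (a ^ᵇ (p xor p′)) ((b ^ᵇ (q xor q′)) x)             ≡⟨ ^ᵇ-xor a² p p′ _ ⟩
          (a ^ᵇ p) ((a ^ᵇ p′) ((b ^ᵇ (q xor q′)) x))
            ≡⟨ cong ((a ^ᵇ p) ∘ (a ^ᵇ p′)) (^ᵇ-xor b² q q′ x) ⟩
          (a ^ᵇ p) ((a ^ᵇ p′) ((b ^ᵇ q) ((b ^ᵇ q′) x)))       ≡⟨ cong (a ^ᵇ p) (^ᵇ-comm ab≡ba p′ q _) ⟩
          (a ^ᵇ p) ((b ^ᵇ q) ((a ^ᵇ p′) ((b ^ᵇ q′) x)))       ∎
      }

    open Action kleinAction using (orbits; burnside; count-invariant-colourings)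

    abstract

      kleinOrbits : ℕ
      kleinOrbits = orbits

      4*kleinOrbits : 4 * kleinOrbits ≡ N + #fixed b + #fixed a + #fixed (a ∘ b)
      4*kleinOrbits = begin
        4 * orbits                                                      ≡⟨ burnside ⟨
        -- The summands follow the enumeration of the group: identity, `b`, `a`, `a ∘ b`.
        #fixed {N} id + (#fixed b + (#fixed a + (#fixed (a ∘ b) + 0)))
          ≡⟨ cong (_+ (#fixed b + (#fixed a + (#fixed (a ∘ b) + 0)))) (#fixed-id N) ⟩
        N + (#fixed b + (#fixed a + (#fixed (a ∘ b) + 0)))
          ≡⟨ reassociate N (#fixed b) (#fixed a) (#fixed (a ∘ b)) ⟩
        N + #fixed b + #fixed a + #fixed (a ∘ b)                        ∎
        where
        reassociate : ∀ w x y z → w + (x + (y + (z + 0))) ≡ w + x + y + z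
        reassociate = solve-∀

      count-klein-invariant : ∀ {k p} {P : Pred (Fin (k ^ N)) p} (P? : Decidable P) →
                              (∀ c → P c ⇔ ((∀ v → colour {k} {N} c (a v) ≡ colour c v) × (∀ v → colour {k} {N} c (b v) ≡ colour c v))) →
                              count P? ≡ k ^ kleinOrbits
      count-klein-invariant {k} P? P⇔ = count-invariant-colourings P? (λ c → generators c ⇔-∘ P⇔ c)
        where
        power : ∀ {f} c → (∀ v → colour {k} {N} c (f v) ≡ colour c v) → ∀ p v → colour {k} {N} c ((f ^ᵇ p) v) ≡ colour c v
        power c e false v = refl
        power c e true  v = e v

        generators : ∀ c → ((∀ v → colour {k} {N} c (a v) ≡ colour c v) × (∀ v → colour {k} {N} c (b v) ≡ colour c v)) ⇔
                           (∀ ((p , q) : Bool × Bool) v → colour {k} {N} c ((a ^ᵇ p) ((b ^ᵇ q) v)) ≡ colour c v)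
        generators c = mk⇔
          (λ (ea , eb) (p , q) v → trans (power c ea p _) (power c eb q v))
          (λ e → e (true , false) , e (false , true))

  module _ {N} (a : Fin N → Fin N) (a² : ∀ x → a (a x) ≡ x) where

    abstract

      -- With the identity as second generator the Klein group acts through `a`; every fixed-point
      -- count then occurs twice in Burnside's lemma, and halving gives the formula for one
      -- involution.
      involutionOrbits : ℕ
      involutionOrbits = kleinOrbits a id a² (λ _ → refl) (λ _ → refl)

      2*involutionOrbits : 2 * involutionOrbits ≡ N + #fixed a
      2*involutionOrbits = *-cancelˡ-≡ (2 * involutionOrbits) (N + #fixed a) 2 (begin
        2 * (2 * involutionOrbits)           ≡⟨ *-assoc 2 2 involutionOrbits ⟨
        4 * involutionOrbits                 ≡⟨ 4*kleinOrbits a id a² (λ _ → refl) (λ _ → refl) ⟩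
        N + #fixed {N} id + #fixed a + #fixed a  ≡⟨ cong (λ m → N + m + #fixed a + #fixed a) (#fixed-id N) ⟩
        N + N + #fixed a + #fixed a          ≡⟨ double N (#fixed a) ⟩
        2 * (N + #fixed a)                   ∎)
        where
        double : ∀ x y → x + x + y + y ≡ 2 * (x + y)
        double = solve-∀

      count-involution-invariant : ∀ {k p} {P : Pred (Fin (k ^ N)) p} (P? : Decidable P) →
                                   (∀ c → P c ⇔ (∀ v → colour {k} {N} c (a v) ≡ colour c v)) →
                                   count P? ≡ k ^ involutionOrbits
      count-involution-invariant P? P⇔ = count-klein-invariant a id a² (λ _ → refl) (λ _ → refl) P?
        (λ c → mk⇔ (λ p → Equivalence.to (P⇔ c) p , λ _ → refl) (λ (e , _) → Equivalence.from (P⇔ c) e))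

  module _ {G : FiniteGroup} {N : ℕ} (A : Action G N) (k : ℕ) where
    open FiniteGroup G
    open Action A
    private module C = Action (colouringAction A k)

    act-involutive : ∀ {a} → a ∙ a ≡ ε → ∀ x → act a (act a x) ≡ x
    act-involutive a² x = trans (sym (act-∙ _ _ x)) (trans (cong (λ g → act g x) a²) (act-ε x))

    -- The exponent is prescribed by the equation that Burnside's lemma gives for the number of
    -- orbits; cancelling the factor identifies the two, so any closed form of `M` can be used.
    count-fixed₁ : ∀ {a} → a ∙ a ≡ ε → ∀ M → 2 * M ≡ N + fixed a → C.fixed a ≡ k ^ M
    count-fixed₁ {a} a² M 2M = trans
      (count-involution-invariant (act a) (act-involutive a²) (λ c → C.act a c ≟ c) (λ c → act≡⇔ A k a c c))
      (cong (k ^_) (*-cancelˡ-≡ (involutionOrbits (act a) (act-involutive a²)) M 2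
        (trans (2*involutionOrbits (act a) (act-involutive a²)) (sym 2M))))

    count-fixed₂ : ∀ {a b} → a ∙ a ≡ ε → b ∙ b ≡ ε → a ∙ b ≡ b ∙ a →
                   ∀ M → 4 * M ≡ N + fixed b + fixed a + fixed (a ∙ b) →
                   count (λ c → (C.act a c ≟ c) ×-dec (C.act b c ≟ c)) ≡ k ^ M
    count-fixed₂ {a} {b} a² b² ab≡ba M 4M = trans
      (count-klein-invariant (act a) (act b) (act-involutive a²) (act-involutive b²) act-comm
        (λ c → (C.act a c ≟ c) ×-dec (C.act b c ≟ c)) (λ c → act≡⇔ A k a c c ×-⇔ act≡⇔ A k b c c))
      (cong (k ^_) (*-cancelˡ-≡ (kleinOrbits (act a) (act b) (act-involutive a²) (act-involutive b²) act-comm) M 4 (begin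
        4 * kleinOrbits (act a) (act b) (act-involutive a²) (act-involutive b²) act-comm
          ≡⟨ 4*kleinOrbits (act a) (act b) (act-involutive a²) (act-involutive b²) act-comm ⟩
        N + fixed b + fixed a + #fixed (act a ∘ act b)
          ≡⟨ cong (N + fixed b + fixed a +_) (sum-cong-≗ (λ x → cong (λ y → ⟦ y ≟ x ⟧) (act-∙ a b x))) ⟨
        N + fixed b + fixed a + fixed (a ∙ b)
          ≡⟨ 4M ⟨
        4 * M ∎)))
      where
      act-comm : ∀ x → act a (act b x) ≡ act b (act a x)
      act-comm x = trans (sym (act-∙ a b x)) (trans (cong (λ g → act g x) ab≡ba) (act-∙ b a x))

-- The dihedral group of the square and its fixed vertices

module SquareSymmetries where
  open Counting
  open Coding
  open Actions
  open KleinActions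
  open import Data.Bool.Base using (Bool; true; false; _xor_)
  open import Data.Bool.Properties using (xor-assoc; xor-same)
  open import Data.Nat using (ℕ; zero; suc; _+_; _*_; _^_; _∸_; _≤_; z≤n; s≤s; ⌊_/2⌋; ⌈_/2⌉)
  open import Data.Nat.Properties using (+-comm; +-identityʳ; *-comm; *-identityʳ; ⌊n/2⌋+⌈n/2⌉≡n; n≡⌊n+n/2⌋; n≡⌈n+n/2⌉; *-distribˡ-+; m+[n∸m]≡n; +-cancelˡ-≡; suc-injective)
  open import Data.Nat.DivMod using (_/_; m*n/n≡m)
  open import Data.Nat.Tactic.RingSolver using (solve-∀)
  open import Data.Fin.Base using (Fin; toℕ; opposite; combine; remQuot)
  open import Data.Fin.Properties using (_≟_; toℕ-injective; toℕ<n; opposite-prop; opposite-involutive; 2↔Bool; combine-remQuot; remQuot-combine)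
  open import Data.Product.Base using (_×_; _,_; swap; uncurry)
  open import Data.Product.Properties using (,-injectiveˡ; ,-injectiveʳ)
  open import Function.Base using (_∘_; id)
  open import Function.Bundles using (_⇔_; mk⇔)
  open import Relation.Nullary using (Dec)
  open import Relation.Nullary.Decidable using (_×-dec_)
  open import Relation.Binary.PropositionalEquality
  open ≡-Reasoning

  _⊕_ : Bool × Bool → Bool × Bool → Bool × Bool
  (p , q) ⊕ (p′ , q′) = p xor p′ , q xor q′

  ⊕-assoc : ∀ x y z → (x ⊕ y) ⊕ z ≡ x ⊕ (y ⊕ z)
  ⊕-assoc (p , q) (p′ , q′) (p″ , q″) = cong₂ _,_ (xor-assoc p p′ p″) (xor-assoc q q′ q″)

  ⊕-same : ∀ x → x ⊕ x ≡ (false , false)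
  ⊕-same (p , q) = cong₂ _,_ (xor-same p) (xor-same q)

  swap-⊕ : ∀ s x y → (swap ^ᵇ s) (x ⊕ y) ≡ (swap ^ᵇ s) x ⊕ (swap ^ᵇ s) y
  swap-⊕ false x y = refl
  swap-⊕ true  x y = refl

  swap-xor : ∀ {A : Set} s t (x : A × A) → (swap ^ᵇ (s xor t)) x ≡ (swap ^ᵇ s) ((swap ^ᵇ t) x)
  swap-xor = ^ᵇ-xor (λ _ → refl)

  swap-cancel : ∀ {A : Set} s (x : A × A) → (swap ^ᵇ s) ((swap ^ᵇ s) x) ≡ x
  swap-cancel false x = refl
  swap-cancel true  x = refl

  -- (s , p) stands for the reflections p followed by the s-th power of the transposition;
  -- moving a transposition past p swaps the two components of p.
  D₄ : FiniteGroup
  D₄ = record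
    { Carrier     = Bool × Bool × Bool
    ; _∙_         = λ (s , p) (t , q) → s xor t , (swap ^ᵇ t) p ⊕ q
    ; ε           = false , false , false
    ; _⁻¹         = λ (s , p) → s , (swap ^ᵇ s) p
    ; assoc       = λ (s , p) (t , q) (u , r) → cong₂ _,_ (xor-assoc s t u) (begin
        (swap ^ᵇ u) ((swap ^ᵇ t) p ⊕ q) ⊕ r                  ≡⟨ cong (_⊕ r) (swap-⊕ u ((swap ^ᵇ t) p) q) ⟩
        ((swap ^ᵇ u) ((swap ^ᵇ t) p) ⊕ (swap ^ᵇ u) q) ⊕ r
          ≡⟨ ⊕-assoc ((swap ^ᵇ u) ((swap ^ᵇ t) p)) ((swap ^ᵇ u) q) r ⟩
        (swap ^ᵇ u) ((swap ^ᵇ t) p) ⊕ ((swap ^ᵇ u) q ⊕ r)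
          ≡⟨ cong (_⊕ ((swap ^ᵇ u) q ⊕ r)) (^ᵇ-comm {f = swap} {g = swap} (λ _ → refl) u t p) ⟩
        (swap ^ᵇ t) ((swap ^ᵇ u) p) ⊕ ((swap ^ᵇ u) q ⊕ r)    ≡⟨ cong (_⊕ ((swap ^ᵇ u) q ⊕ r)) (swap-xor t u p) ⟨
        (swap ^ᵇ (t xor u)) p ⊕ ((swap ^ᵇ u) q ⊕ r)          ∎)
    ; identityˡ   = λ { (false , _) → refl ; (true , _) → refl }
    ; inverseˡ    = λ (s , p) → cong₂ _,_ (xor-same s) (trans (cong (_⊕ p) (swap-cancel s p)) (⊕-same p))
    ; inverseʳ    = λ (s , p) → cong₂ _,_ (xor-same s) (⊕-same ((swap ^ᵇ s) p))
    ; order       = 8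
    ; enumeration = ×-enumeration 2↔Bool (×-enumeration 2↔Bool 2↔Bool)
    }

  open FiniteGroup D₄ using (Carrier; _∙_; ε; _⁻¹)

  flip₁ flip₂ halfTurn transposition antitransposition : Carrier
  flip₁             = false , true  , false
  flip₂             = false , false , true
  halfTurn          = false , true  , true
  transposition     = true  , false , false
  antitransposition = true  , true  , true

  module _ {n : ℕ} where

    reflect : Bool × Bool → Fin n × Fin n → Fin n × Fin n
    reflect (p , q) (i , j) = (opposite ^ᵇ p) i , (opposite ^ᵇ q) j

    move : Carrier → Fin n × Fin n → Fin n × Fin n
    move (s , p) v = (swap ^ᵇ s) (reflect p v)

    reflect-⊕ : ∀ p q v → reflect (p ⊕ q) v ≡ reflect p (reflect q v)
    reflect-⊕ (p , q) (p′ , q′) (i , j) = cong₂ _,_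
      (^ᵇ-xor opposite-involutive p p′ i) (^ᵇ-xor opposite-involutive q q′ j)

    reflect-swap : ∀ p t v → reflect p ((swap ^ᵇ t) v) ≡ (swap ^ᵇ t) (reflect ((swap ^ᵇ t) p) v)
    reflect-swap p false v = refl
    reflect-swap p true  v = refl

    move-∙ : ∀ g h v → move (g ∙ h) v ≡ move g (move h v)
    move-∙ (s , p) (t , q) v = begin
      (swap ^ᵇ (s xor t)) (reflect ((swap ^ᵇ t) p ⊕ q) v)               ≡⟨ swap-xor s t _ ⟩
      (swap ^ᵇ s) ((swap ^ᵇ t) (reflect ((swap ^ᵇ t) p ⊕ q) v))
        ≡⟨ cong ((swap ^ᵇ s) ∘ (swap ^ᵇ t)) (reflect-⊕ ((swap ^ᵇ t) p) q v) ⟩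
      (swap ^ᵇ s) ((swap ^ᵇ t) (reflect ((swap ^ᵇ t) p) (reflect q v)))
        ≡⟨ cong (swap ^ᵇ s) (reflect-swap p t (reflect q v)) ⟨
      (swap ^ᵇ s) (reflect p ((swap ^ᵇ t) (reflect q v)))               ∎

  module _ (n : ℕ) where

    vertex : Fin (n * n) → Fin n × Fin n
    vertex = remQuot n

    index : Fin n × Fin n → Fin (n * n)
    index = uncurry combine

    vertex-index : ∀ v → vertex (index v) ≡ v
    vertex-index (i , j) = remQuot-combine i j

    index-vertex : ∀ x → index (vertex x) ≡ x
    index-vertex = combine-remQuot {n} n

    index-injective : ∀ {u v} → index u ≡ index v → u ≡ v
    index-injective {u} {v} e = trans (sym (vertex-index u)) (trans (cong vertex e) (vertex-index v))

    squareAction : Action D₄ (n * n)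
    squareAction = record
      { act   = λ g x → index (move g (vertex x))
      ; act-ε = index-vertex
      ; act-∙ = λ g h x → cong index (trans (move-∙ g h (vertex x)) (cong (move g) (sym (vertex-index (move h (vertex x))))))
      }

    open Action squareAction using (act; fixed)

    -- This is 1 for odd `n` and 0 for even `n`; as an idempotent unknown it covers both parities at
    -- once.
    #centre : ℕ
    #centre = #fixed (opposite {n})

    -- The sum over codes splits into rows and columns, so fixed vertices can be counted by
    -- coordinates.
    fixed-move : ∀ g {P : Fin n → Fin n → Set} (P? : ∀ i j → Dec (P i j)) → (∀ i j → move g (i , j) ≡ (i , j) ⇔ P i j) →
                 fixed g ≡ sum (λ i → sum (λ j → ⟦ P? i j ⟧))
    fixed-move g P? P⇔ = trans (sum-* n (λ x → ⟦ act g x ≟ x ⟧))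
      (sum-cong-≗ {n} (λ i → sum-cong-≗ {n} (λ j → ⟦⟧-cong (coded i j) (act g (combine i j) ≟ combine i j) (P? i j))))
      where
      open Function.Bundles.Equivalence
      coded : ∀ i j → act g (combine i j) ≡ combine i j ⇔ _
      coded i j = mk⇔
        (λ e → to (P⇔ i j) (trans (cong (move g) (sym (vertex-index (i , j)))) (index-injective e)))
        (λ p → cong index (trans (cong (move g) (vertex-index (i , j))) (from (P⇔ i j) p)))

    fixed-flip₁ : fixed flip₁ ≡ #centre * n
    fixed-flip₁ = begin
      fixed flip₁
        ≡⟨ fixed-move flip₁ (λ i j → opposite i ≟ i) (λ i j → mk⇔ ,-injectiveˡ (cong (_, j))) ⟩
      sum {n} (λ i → sum {n} (λ _ → ⟦ opposite i ≟ i ⟧))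
        ≡⟨ sum-cong-≗ {n} (λ i → trans (sum-const n ⟦ opposite i ≟ i ⟧) (*-comm n ⟦ opposite i ≟ i ⟧)) ⟩
      sum {n} (λ i → ⟦ opposite i ≟ i ⟧ * n)            ≡⟨ *-distribʳ-sum n (λ i → ⟦ opposite {n} i ≟ i ⟧) ⟨
      #centre * n                                       ∎

    fixed-flip₂ : fixed flip₂ ≡ n * #centre
    fixed-flip₂ = trans
      (fixed-move flip₂ (λ i j → opposite j ≟ j) (λ i j → mk⇔ ,-injectiveʳ (cong (i ,_))))
      (sum-const n #centre)

    fixed-halfTurn : fixed halfTurn ≡ #centre * #centre
    fixed-halfTurn = begin
      fixed halfTurn
        ≡⟨ fixed-move halfTurn (λ i j → (opposite i ≟ i) ×-dec (opposite j ≟ j))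
             (λ i j → mk⇔ (λ e → ,-injectiveˡ e , ,-injectiveʳ e) (λ (e , e′) → cong₂ _,_ e e′)) ⟩
      sum {n} (λ i → sum {n} (λ j → ⟦ (opposite i ≟ i) ×-dec (opposite j ≟ j) ⟧))
        ≡⟨ sum-cong-≗ {n} (λ i → sum-cong-≗ {n} (λ j → ⟦×-dec⟧ (opposite i ≟ i) (opposite {n} j ≟ j))) ⟩
      sum {n} (λ i → sum {n} (λ j → ⟦ opposite i ≟ i ⟧ * ⟦ opposite j ≟ j ⟧))
        ≡⟨ sum-product (λ i → ⟦ opposite {n} i ≟ i ⟧) (λ j → ⟦ opposite {n} j ≟ j ⟧) ⟩
      #centre * #centre ∎

    -- The graph of a function has one point per row; the axes of both diagonal reflections have
    -- this form.
    sum-singletons : {P : Fin n → Fin n → Set} (P? : ∀ i j → Dec (P i j)) (f : Fin n → Fin n) → (∀ i j → P i j ⇔ j ≡ f i) →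
                     sum (λ i → sum (λ j → ⟦ P? i j ⟧)) ≡ n
    sum-singletons P? f P⇔ = begin
      sum (λ i → sum (λ j → ⟦ P? i j ⟧))
        ≡⟨ sum-cong-≗ {n} (λ i → count-singleton (P? i) (f i) (from (P⇔ i (f i)) refl) (λ j → to (P⇔ i j))) ⟩
      sum {n} (λ _ → 1)                  ≡⟨ sum-const n 1 ⟩
      n * 1                              ≡⟨ *-identityʳ n ⟩
      n                                  ∎
      where open Function.Bundles.Equivalence

    fixed-transposition : fixed transposition ≡ n
    fixed-transposition = trans
      (fixed-move transposition (λ i j → j ≟ i) (λ i j → mk⇔ ,-injectiveˡ (λ { refl → refl })))
      (sum-singletons (λ i j → j ≟ i) id (λ i j → mk⇔ id id))

    fixed-antitransposition : fixed antitransposition ≡ n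
    fixed-antitransposition = trans
      (fixed-move antitransposition (λ i j → j ≟ opposite i)
        (λ i j → mk⇔ (sym ∘ ,-injectiveʳ) (λ { refl → cong (_, opposite i) (opposite-involutive i) })))
      (sum-singletons (λ i j → j ≟ opposite i) opposite (λ i j → mk⇔ id id))

    -- A fixed index i satisfies 2i + 1 = n, which determines it.
    #centre≤1 : #centre ≤ 1
    #centre≤1 = count-subsingleton (λ i → opposite i ≟ i) (λ i j ei ej →
      toℕ-injective (halve (suc-injective (trans (middle i ei) (sym (middle j ej))))))
      where
      middle : ∀ i → opposite i ≡ i → suc (toℕ i + toℕ i) ≡ n
      middle i e = begin
        suc (toℕ i) + toℕ i             ≡⟨ cong (λ k → suc (toℕ i) + toℕ k) e ⟨
        suc (toℕ i) + toℕ (opposite i)  ≡⟨ cong (suc (toℕ i) +_) (opposite-prop i) ⟩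
        suc (toℕ i) + (n ∸ suc (toℕ i)) ≡⟨ m+[n∸m]≡n (toℕ<n i) ⟩
        n                               ∎

      halve : ∀ {x y} → x + x ≡ y + y → x ≡ y
      halve {x} {y} e = trans (n≡⌊n+n/2⌋ x) (trans (cong ⌊_/2⌋ e) (sym (n≡⌊n+n/2⌋ y)))

    #centre² : #centre * #centre ≡ #centre
    #centre² = idempotent #centre≤1
      where
      idempotent : ∀ {c} → c ≤ 1 → c * c ≡ c
      idempotent z≤n       = refl
      idempotent (s≤s z≤n) = refl

    -- Turns the Burnside equation of an involution with at most one fixed point into a ceiling.
    ⌈half⌉ : ∀ M {N c} → 2 * M ≡ N + c → c ≤ 1 → ⌈ N /2⌉ ≡ M
    ⌈half⌉ M {N} {zero}     e _ =
      trans (cong ⌈_/2⌉ (trans (sym (+-identityʳ N)) (trans (sym e) (cong (M +_) (+-identityʳ M))))) (sym (n≡⌈n+n/2⌉ M))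
    ⌈half⌉ M {N} {suc zero} e _ =
      -- `⌈ N /2⌉` unfolds to `⌊ suc N /2⌋`.
      trans (cong ⌊_/2⌋ (trans (+-comm 1 N) (trans (sym e) (cong (M +_) (+-identityʳ M))))) (sym (n≡⌊n+n/2⌋ M))
    ⌈half⌉ M {c = suc (suc _)} e (s≤s ())

    -- Burnside's lemma for `opposite` on one side of the grid, which has `⌈ n /2⌉` orbits.
    2*⌈n/2⌉ : 2 * ⌈ n /2⌉ ≡ n + #centre
    2*⌈n/2⌉ = trans (cong (2 *_) (⌈half⌉ (involutionOrbits opposite opposite-involutive) doubled #centre≤1)) doubled
      where doubled = 2*involutionOrbits (opposite {n}) opposite-involutive

    ⌈n/2⌉≡⌊n/2⌋+#centre : ⌈ n /2⌉ ≡ ⌊ n /2⌋ + #centre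
    ⌈n/2⌉≡⌊n/2⌋+#centre = +-cancelˡ-≡ ⌈ n /2⌉ _ _ (begin
      ⌈ n /2⌉ + ⌈ n /2⌉              ≡⟨ cong (⌈ n /2⌉ +_) (+-identityʳ ⌈ n /2⌉) ⟨
      2 * ⌈ n /2⌉                    ≡⟨ 2*⌈n/2⌉ ⟩
      n + #centre                    ≡⟨ cong (_+ #centre) (⌊n/2⌋+⌈n/2⌉≡n n) ⟨
      ⌊ n /2⌋ + ⌈ n /2⌉ + #centre    ≡⟨ rotate ⌊ n /2⌋ ⌈ n /2⌉ #centre ⟩
      ⌈ n /2⌉ + (⌊ n /2⌋ + #centre)  ∎)
      where
      rotate : ∀ x y z → x + y + z ≡ y + (x + z)
      rotate = solve-∀

  module _ (n k : ℕ) where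
    open Action (squareAction n) using (fixed)
    open Action (colouringAction (squareAction n) k) using (act) renaming (fixed to invariant)

    private
      c = #centre n

    -- The half turn fixes at most a central vertex, so its orbits number half of n², rounded up.
    invariant-halfTurn : invariant halfTurn ≡ k ^ ⌈ n ^ 2 /2⌉
    invariant-halfTurn = trans
      (count-fixed₁ (squareAction n) k {halfTurn} refl M 2M)
      (cong (k ^_) (sym (trans (cong (λ m → ⌈ n * m /2⌉) (*-identityʳ n)) 
        (⌈half⌉ n M (trans 2M (cong (n * n +_) (trans (fixed-halfTurn n) (#centre² n)))) (#centre≤1 n)))))
      where
      M = involutionOrbits (Action.act (squareAction n) halfTurn) (act-involutive (squareAction n) k {halfTurn} refl)
      2M = 2*involutionOrbits (Action.act (squareAction n) halfTurn) (act-involutive (squareAction n) k {halfTurn} refl)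

    2*n*⌈n/2⌉ : 2 * (n * ⌈ n /2⌉) ≡ n * n + n * c
    2*n*⌈n/2⌉ = begin
      2 * (n * ⌈ n /2⌉)  ≡⟨ left-comm 2 n ⌈ n /2⌉ ⟩
      n * (2 * ⌈ n /2⌉)  ≡⟨ cong (n *_) (2*⌈n/2⌉ n) ⟩
      n * (n + c)        ≡⟨ *-distribˡ-+ n n c ⟩
      n * n + n * c      ∎
      where
      left-comm : ∀ x y z → x * (y * z) ≡ y * (x * z)
      left-comm = solve-∀

    invariant-flip₁ : invariant flip₁ ≡ k ^ (n * ⌈ n /2⌉)
    invariant-flip₁ = count-fixed₁ (squareAction n) k {flip₁} refl (n * ⌈ n /2⌉)
      (trans 2*n*⌈n/2⌉ (cong (n * n +_) (trans (*-comm n c) (sym (fixed-flip₁ n)))))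

    invariant-flip₂ : invariant flip₂ ≡ k ^ (n * ⌈ n /2⌉)
    invariant-flip₂ = count-fixed₁ (squareAction n) k {flip₂} refl (n * ⌈ n /2⌉)
      (trans 2*n*⌈n/2⌉ (cong (n * n +_) (sym (fixed-flip₂ n))))

    -- The n vertices of the axis are fixed, which gives (n² + n) / 2 orbits; the division is exact
    -- because the dividend is `M * 2`.
    invariant-diagonal : ∀ {g} → g ∙ g ≡ ε → fixed g ≡ n → invariant g ≡ k ^ (n * (n + 1) / 2)
    invariant-diagonal {g} g² fixed≡n = trans
      (count-fixed₁ (squareAction n) k {g} g² M 2M)
      (cong (k ^_) (begin
        M                    ≡⟨ m*n/n≡m M 2 ⟨
        (M * 2) / 2          ≡⟨ cong (_/ 2) (begin
          M * 2                ≡⟨ *-comm M 2 ⟩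
          2 * M                ≡⟨ 2M ⟩
          n * n + fixed g      ≡⟨ cong (n * n +_) fixed≡n ⟩
          n * n + n            ≡⟨ cong (n * n +_) (*-identityʳ n) ⟨
          n * n + n * 1        ≡⟨ *-distribˡ-+ n n 1 ⟨
          n * (n + 1)          ∎) ⟩
        (n * (n + 1)) / 2    ∎))
      where
      M = involutionOrbits (Action.act (squareAction n) g) (act-involutive (squareAction n) k {g} g²)
      2M = 2*involutionOrbits (Action.act (squareAction n) g) (act-involutive (squareAction n) k {g} g²)

    -- The four fixed-point counts are the terms of (n + c)², and n + c is twice ⌈n/2⌉: the orbits
    -- form a square of side ⌈n/2⌉.
    invariant-flips : count (λ x → (act flip₁ x ≟ x) ×-dec (act flip₂ x ≟ x)) ≡ k ^ (⌈ n /2⌉ ^ 2)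
    invariant-flips = count-fixed₂ (squareAction n) k {flip₁} {flip₂} refl refl refl (⌈ n /2⌉ ^ 2) (begin
      4 * ⌈ n /2⌉ ^ 2                        ≡⟨ square-double ⌈ n /2⌉ ⟩
      (2 * ⌈ n /2⌉) * (2 * ⌈ n /2⌉)          ≡⟨ cong (λ m → m * m) (2*⌈n/2⌉ n) ⟩
      (n + c) * (n + c)                      ≡⟨ expand n c ⟩
      n * n + n * c + c * n + c * c
        ≡⟨ cong₂ _+_ (cong₂ _+_ (cong (n * n +_) (fixed-flip₂ n)) (fixed-flip₁ n)) (fixed-halfTurn n) ⟨
      n * n + fixed flip₂ + fixed flip₁ + fixed halfTurn ∎)
      where
      square-double : ∀ x → 4 * (x * (x * 1)) ≡ (2 * x) * (2 * x)
      square-double = solve-∀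
      expand : ∀ x y → (x + y) * (x + y) ≡ x * x + x * y + y * x + y * y
      expand = solve-∀

    invariant-diagonals : count (λ x → (act transposition x ≟ x) ×-dec (act antitransposition x ≟ x)) ≡
                          k ^ (⌈ n /2⌉ * ⌈ n + 1 /2⌉)
    invariant-diagonals = count-fixed₂ (squareAction n) k {transposition} {antitransposition} refl refl refl (⌈ n /2⌉ * ⌈ n + 1 /2⌉) (begin
      4 * (⌈ n /2⌉ * ⌈ n + 1 /2⌉)
        -- `⌈ 1 + n /2⌉` unfolds to `1 + ⌊ n /2⌋`; n is to be read as 2f + c.
        ≡⟨ cong₂ (λ x y → 4 * (x * ⌈ y /2⌉)) (⌈n/2⌉≡⌊n/2⌋+#centre n) (+-comm n 1) ⟩
      4 * ((f + c) * (1 + f))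
        ≡⟨ expand f c ⟩
      4 * (f * f) + 4 * f + 4 * (f * c) + 2 * c + c + c
        -- Of the four linear terms in c two become squares, to match n² + 2n + c², whose part 2n
        -- supplies just two.
        ≡⟨ cong (λ m → 4 * (f * f) + 4 * f + 4 * (f * c) + 2 * c + m + m) (#centre² n) ⟨
      4 * (f * f) + 4 * f + 4 * (f * c) + 2 * c + c * c + c * c
        ≡⟨ collect f c ⟩
      (f + (f + c)) * (f + (f + c)) + (f + (f + c)) + (f + (f + c)) + c * c
        ≡⟨ cong (λ m → m * m + m + m + c * c) (trans (cong (f +_) (sym (⌈n/2⌉≡⌊n/2⌋+#centre n))) (⌊n/2⌋+⌈n/2⌉≡n n)) ⟩
      n * n + n + n + c * c
        ≡⟨ cong₂ _+_ (cong₂ _+_ (cong (n * n +_) (fixed-antitransposition n)) (fixed-transposition n)) (fixed-halfTurn n) ⟨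
      n * n + fixed antitransposition + fixed transposition + fixed halfTurn ∎)
      where
      f = ⌊ n /2⌋
      expand : ∀ x y → 4 * ((x + y) * (1 + x)) ≡ 4 * (x * x) + 4 * x + 4 * (x * y) + 2 * y + y + y
      expand = solve-∀
      collect : ∀ x y → 4 * (x * x) + 4 * x + 4 * (x * y) + 2 * y + y * y + y * y ≡
                        (x + (x + y)) * (x + (x + y)) + (x + (x + y)) + (x + (x + y)) + y * y
      collect = solve-∀

-- Möbius inversion for the stabilizers of colourings

module FreeColourings where
  open Counting
  open Coding
  open Actions
  open SquareSymmetries
  open import Data.Bool.Base using (true; false)
  open import Data.Nat using (ℕ; _+_; _*_; _^_; ⌈_/2⌉)
  open import Data.Nat.Properties using (*-identityʳ)
  open import Data.Nat.DivMod using (_/_)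
  open import Data.Fin.Base using (Fin)
  open import Data.Fin.Properties using (_≟_)
  open import Data.Product.Base using (_×_; _,_)
  open import Function.Base using (case_of_)
  open import Function.Bundles using (_⇔_; mk⇔; Equivalence)
  open import Relation.Nullary using (Dec; yes; no; ¬_; contradiction)
  open import Relation.Nullary.Decidable using (_×-dec_)
  open import Relation.Binary.PropositionalEquality
  open ≡-Reasoning

  -- Möbius inversion over the subgroups of D₄, evaluated on the stabilizer of one point: F says that
  -- the stabilizer is trivial, and R, H, V, D, E that it contains the half turn, the two flips and
  -- the two diagonal reflections.
  module _ {F R H V D E : Set} (F⇔ : F ⇔ (¬ R × ¬ H × ¬ V × ¬ D × ¬ E))
           (hv : H → V → R) (rh : R → H → V) (rv : R → V → H)
           (de : D → E → R) (rd : R → D → E) (re : R → E → D)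
           (hd : H → D → R) (he : H → E → R) (vd : V → D → R) (ve : V → E → R) where

    stabilizer-möbius : (F? : Dec F) (R? : Dec R) (H? : Dec H) (V? : Dec V) (D? : Dec D) (E? : Dec E) →
      ⟦ F? ⟧ + (⟦ R? ⟧ + ⟦ H? ⟧ + ⟦ V? ⟧ + ⟦ D? ⟧ + ⟦ E? ⟧) ≡ 1 + (2 * ⟦ H? ×-dec V? ⟧ + 2 * ⟦ D? ×-dec E? ⟧)
    stabilizer-möbius (yes f) R? H? V? D? E? with Equivalence.to F⇔ f
    stabilizer-möbius (yes f) (yes r) _ _ _ _ | ¬r , _                         = contradiction r ¬r
    stabilizer-möbius (yes f) (no _) (yes h) _ _ _ | _ , ¬h , _                = contradiction h ¬h
    stabilizer-möbius (yes f) (no _) (no _) (yes v) _ _ | _ , _ , ¬v , _       = contradiction v ¬v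
    stabilizer-möbius (yes f) (no _) (no _) (no _) (yes d) _ | _ , _ , _ , ¬d , _ = contradiction d ¬d
    stabilizer-möbius (yes f) (no _) (no _) (no _) (no _) (yes e) | _ , _ , _ , _ , ¬e = contradiction e ¬e
    stabilizer-möbius (yes f) (no _) (no _) (no _) (no _) (no _) | _           = refl
    stabilizer-möbius (no ¬f) (no ¬r) (no ¬h) (no ¬v) (no ¬d) (no ¬e) = contradiction (Equivalence.from F⇔ (¬r , ¬h , ¬v , ¬d , ¬e)) ¬f
    -- Without the half turn a nontrivial stabilizer is generated by one reflection.
    stabilizer-möbius (no _) (no _)  (yes _) (no _)  (no _)  (no _)  = refl
    stabilizer-möbius (no _) (no _)  (no _)  (yes _) (no _)  (no _)  = refl
    stabilizer-möbius (no _) (no _)  (no _)  (no _)  (yes _) (no _)  = refl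
    stabilizer-möbius (no _) (no _)  (no _)  (no _)  (no _)  (yes _) = refl
    stabilizer-möbius (no _) (no ¬r) (yes h) (yes v) _       _       = contradiction (hv h v) ¬r
    stabilizer-möbius (no _) (no ¬r) (yes h) (no _)  (yes d) _       = contradiction (hd h d) ¬r
    stabilizer-möbius (no _) (no ¬r) (yes h) (no _)  (no _)  (yes e) = contradiction (he h e) ¬r
    stabilizer-möbius (no _) (no ¬r) (no _)  (yes v) (yes d) _       = contradiction (vd v d) ¬r
    stabilizer-möbius (no _) (no ¬r) (no _)  (yes v) (no _)  (yes e) = contradiction (ve v e) ¬r
    stabilizer-möbius (no _) (no ¬r) (no _)  (no _)  (yes d) (yes e) = contradiction (de d e) ¬r
    stabilizer-möbius (no _) (yes r) (yes h) (no ¬v) _       _       = contradiction (rh r h) ¬v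
    stabilizer-möbius (no _) (yes r) (no ¬h) (yes v) _       _       = contradiction (rv r v) ¬h
    stabilizer-möbius (no _) (yes r) _       _       (yes d) (no ¬e) = contradiction (rd r d) ¬e
    stabilizer-möbius (no _) (yes r) _       _       (no ¬d) (yes e) = contradiction (re r e) ¬d
    -- With the half turn the stabilizer is D₄, one of the Klein groups or a group of rotations; the
    -- balances are 5 = 1 + 4, 3 = 1 + 2 (twice) and 1 = 1.
    stabilizer-möbius (no _) (yes _) (yes _) (yes _) (yes _) (yes _) = refl
    stabilizer-möbius (no _) (yes _) (yes _) (yes _) (no _)  (no _)  = refl
    stabilizer-möbius (no _) (yes _) (no _)  (no _)  (yes _) (yes _) = refl
    stabilizer-möbius (no _) (yes _) (no _)  (no _)  (no _)  (no _)  = refl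

  sum-möbius : ∀ N (f r h v d e p q : Fin N → ℕ) →
               (∀ i → f i + (r i + h i + v i + d i + e i) ≡ 1 + (2 * p i + 2 * q i)) →
               sum f + (sum r + sum h + sum v + sum d + sum e) ≡ N + (2 * sum p + 2 * sum q)
  sum-möbius N f r h v d e p q pointwise = begin
    sum f + (sum r + sum h + sum v + sum d + sum e)
      ≡⟨ cong (sum f +_) (trans (∑-distrib-+ (λ i → r i + h i + v i + d i) e)
           (cong (_+ sum e) (trans (∑-distrib-+ (λ i → r i + h i + v i) d)
           (cong (_+ sum d) (trans (∑-distrib-+ (λ i → r i + h i) v)
           (cong (_+ sum v) (∑-distrib-+ r h))))))) ⟨
    sum f + sum (λ i → r i + h i + v i + d i + e i)     ≡⟨ ∑-distrib-+ f (λ i → r i + h i + v i + d i + e i) ⟨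
    sum (λ i → f i + (r i + h i + v i + d i + e i))     ≡⟨ sum-cong-≗ pointwise ⟩
    sum (λ i → 1 + (2 * p i + 2 * q i))                 ≡⟨ ∑-distrib-+ (λ _ → 1) (λ i → 2 * p i + 2 * q i) ⟩
    sum {N} (λ _ → 1) + sum (λ i → 2 * p i + 2 * q i)
      ≡⟨ cong₂ _+_ (trans (sum-const N 1) (*-identityʳ N)) (∑-distrib-+ (λ i → 2 * p i) (λ i → 2 * q i)) ⟩
    N + (sum (λ i → 2 * p i) + sum (λ i → 2 * q i))
      ≡⟨ cong₂ (λ x y → N + (x + y)) (*-distribˡ-sum 2 p) (*-distribˡ-sum 2 q) ⟨
    N + (2 * sum p + 2 * sum q)                         ∎

  module _ (n k : ℕ) where
    open FiniteGroup D₄ using (_∙_)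
    open Action (colouringAction (squareAction n) k) public using (act; act-∙; Free; Free?; minimizer; freeOrbits; freeOrbit; freeOrbit-unique; representative; representative-free; representative-freeOrbit; free-orbit-count)

    fixed-∙ : ∀ g h {c} → act g c ≡ c → act h c ≡ c → act (g ∙ h) c ≡ c
    fixed-∙ g h eg eh = trans (act-∙ g h _) (trans (cong (act g) eh) eg)

    fixed-² : ∀ g {c} → act g c ≡ c → act (g ∙ g) c ≡ c
    fixed-² g e = fixed-∙ g g e e

    -- The five involutions suffice: a quarter turn fixing the colouring has the half turn as its
    -- square.
    Free⇔ : ∀ c → Free c ⇔
            (act halfTurn c ≢ c × act flip₁ c ≢ c × act flip₂ c ≢ c × act transposition c ≢ c × act antitransposition c ≢ c)
    Free⇔ c = mk⇔
      (λ free → (λ e → case free halfTurn e of λ ()) , (λ e → case free flip₁ e of λ ()) , (λ e → case free flip₂ e of λ ())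
              , (λ e → case free transposition e of λ ()) , (λ e → case free antitransposition e of λ ()))
      λ { (¬r , ¬h , ¬v , ¬d , ¬e) (false , false , false) _ → refl
        ; (¬r , ¬h , ¬v , ¬d , ¬e) (false , true  , true)  r → contradiction r ¬r
        ; (¬r , ¬h , ¬v , ¬d , ¬e) (false , true  , false) h → contradiction h ¬h
        ; (¬r , ¬h , ¬v , ¬d , ¬e) (false , false , true)  v → contradiction v ¬v
        ; (¬r , ¬h , ¬v , ¬d , ¬e) (true  , false , false) d → contradiction d ¬d
        ; (¬r , ¬h , ¬v , ¬d , ¬e) (true  , true  , true)  e → contradiction e ¬e
        ; (¬r , ¬h , ¬v , ¬d , ¬e) (true  , true  , false) ρ → contradiction (fixed-² (true , true , false) ρ) ¬r
        ; (¬r , ¬h , ¬v , ¬d , ¬e) (true  , false , true)  ρ → contradiction (fixed-² (true , false , true) ρ) ¬r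
        }

    -- The negative terms of the Möbius sum stand on the left, which keeps the identity in the
    -- natural numbers.
    8*freeOrbits : 8 * freeOrbits + (k ^ ⌈ n ^ 2 /2⌉ + k ^ (n * ⌈ n /2⌉) + k ^ (n * ⌈ n /2⌉)
                                + k ^ (n * (n + 1) / 2) + k ^ (n * (n + 1) / 2))
               ≡ k ^ (n ^ 2) + (2 * k ^ (⌈ n /2⌉ ^ 2) + 2 * k ^ (⌈ n /2⌉ * ⌈ n + 1 /2⌉))
    8*freeOrbits = begin
      8 * freeOrbits + (k ^ ⌈ n ^ 2 /2⌉ + k ^ (n * ⌈ n /2⌉) + k ^ (n * ⌈ n /2⌉) + k ^ (n * (n + 1) / 2) + k ^ (n * (n + 1) / 2))
        ≡⟨ cong₂ _+_ free-orbit-count (cong₂ _+_ (cong₂ _+_ (cong₂ _+_ (cong₂ _+_ (invariant-halfTurn n k) (invariant-flip₁ n k)) (invariant-flip₂ n k))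
             (invariant-diagonal n k {transposition} refl (fixed-transposition n)))
             (invariant-diagonal n k {antitransposition} refl (fixed-antitransposition n))) ⟨
      count Free? + (invariants halfTurn + invariants flip₁ + invariants flip₂ + invariants transposition + invariants antitransposition)
        ≡⟨ sum-möbius (k ^ (n * n)) (λ c → ⟦ Free? c ⟧) (λ c → ⟦ Fixed? halfTurn c ⟧) (λ c → ⟦ Fixed? flip₁ c ⟧) (λ c → ⟦ Fixed? flip₂ c ⟧)
             (λ c → ⟦ Fixed? transposition c ⟧) (λ c → ⟦ Fixed? antitransposition c ⟧)
             (λ c → ⟦ Fixed? flip₁ c ×-dec Fixed? flip₂ c ⟧) (λ c → ⟦ Fixed? transposition c ×-dec Fixed? antitransposition c ⟧)
             (λ c → stabilizer-möbius (Free⇔ c)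
               (fixed-∙ flip₁ flip₂) (fixed-∙ halfTurn flip₁) (fixed-∙ halfTurn flip₂)
               (fixed-∙ transposition antitransposition) (fixed-∙ halfTurn transposition) (fixed-∙ halfTurn antitransposition)
               -- The product of a flip and a diagonal reflection is a quarter turn; squaring it
               -- yields the half turn.
               (λ h d → fixed-² (flip₁ ∙ transposition) (fixed-∙ flip₁ transposition h d))
               (λ h e → fixed-² (flip₁ ∙ antitransposition) (fixed-∙ flip₁ antitransposition h e))
               (λ v d → fixed-² (flip₂ ∙ transposition) (fixed-∙ flip₂ transposition v d))
               (λ v e → fixed-² (flip₂ ∙ antitransposition) (fixed-∙ flip₂ antitransposition v e))
               (Free? c) (Fixed? halfTurn c) (Fixed? flip₁ c) (Fixed? flip₂ c) (Fixed? transposition c) (Fixed? antitransposition c)) ⟩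
      k ^ (n * n) + (2 * count (λ c → Fixed? flip₁ c ×-dec Fixed? flip₂ c)
                     + 2 * count (λ c → Fixed? transposition c ×-dec Fixed? antitransposition c))
        ≡⟨ cong₂ _+_ (cong (λ m → k ^ (n * m)) (sym (*-identityʳ n)))
             (cong₂ (λ x y → 2 * x + 2 * y) (invariant-flips n k) (invariant-diagonals n k)) ⟩
      k ^ (n ^ 2) + (2 * k ^ (⌈ n /2⌉ ^ 2) + 2 * k ^ (⌈ n /2⌉ * ⌈ n + 1 /2⌉)) ∎
      where
      Fixed? : ∀ g c → Dec (act g c ≡ c)
      Fixed? g c = act g c ≟ c

      invariants : FiniteGroup.Carrier D₄ → ℕ
      invariants g = count (Fixed? g)

-- Automorphisms of the grid

module GridAutomorphisms where
  open import Defs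
  open Actions using (module FiniteGroup)
  open KleinActions using (_^ᵇ_)
  open SquareSymmetries using (D₄; move; move-∙; reflect)
  open FiniteGroup D₄ using (Carrier; ε; _⁻¹; inverseˡ; inverseʳ)
  open import Data.Bool.Base using (true; false)
  open import Data.Nat using (ℕ; zero; suc; _+_; _∸_; _<_; s<s; z<s)
  open import Data.Nat.Properties using (1+n≢n; <⇒≢; suc-injective; n<1+n; <-trans; m<n⇒m<1+n; +-suc; +-∸-assoc; _<?_; ≮⇒≥; ≤-antisym)
  open import Data.Fin.Base using (Fin; zero; suc; toℕ; fromℕ<; inject₁; opposite)
  open import Data.Fin.Properties using (toℕ-injective; toℕ-inject₁; toℕ-fromℕ<; toℕ<n; toℕ-fromℕ; opposite-prop)
  open import Data.Product.Base using (∃; _×_; _,_; proj₁; proj₂; swap)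
  open import Data.Sum.Base using (_⊎_; inj₁; inj₂)
  open import Function.Base using (_∘_)
  open import Function.Bundles using (mk⇔; mk↔ₛ′; Equivalence)
  open import Relation.Nullary using (contradiction; yes; no)
  open import Relation.Binary.PropositionalEquality

  Consecutive : ℕ → ℕ → Set
  Consecutive a b = suc a ≡ b ⊎ suc b ≡ a

  -- Adjacency in the quarter plane, without the far borders of the grid: candidates for a neighbour
  -- can be listed by pattern matching on natural numbers.
  Near : ℕ × ℕ → ℕ × ℕ → Set
  Near (a , b) (a′ , b′) = (a ≡ a′ × Consecutive b b′) ⊎ (Consecutive a a′ × b ≡ b′)

  common-neighbours : ∀ {i j} p → Near p (suc i , j) → Near p (i , suc j) → p ≡ (i , j) ⊎ p ≡ (suc i , suc j)
  common-neighbours _ (inj₁ (refl , inj₁ refl)) (inj₁ (() , _))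
  common-neighbours _ (inj₁ (refl , inj₁ refl)) (inj₂ (_ , ()))
  common-neighbours _ (inj₁ (refl , inj₂ refl)) _ = inj₂ refl
  common-neighbours _ (inj₂ (inj₁ refl , refl)) _ = inj₁ refl
  common-neighbours _ (inj₂ (inj₂ refl , refl)) (inj₁ (() , _))
  common-neighbours _ (inj₂ (inj₂ refl , refl)) (inj₂ (_ , ()))

  top-neighbours : ∀ {j} p → Near p (0 , suc j) → p ≡ (0 , j) ⊎ p ≡ (1 , suc j) ⊎ p ≡ (0 , suc (suc j))
  top-neighbours _ (inj₁ (refl , inj₁ refl)) = inj₁ refl
  top-neighbours _ (inj₁ (refl , inj₂ refl)) = inj₂ (inj₂ refl)
  top-neighbours _ (inj₂ (inj₂ refl , refl)) = inj₂ (inj₁ refl)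

  left-neighbours : ∀ {i} p → Near p (suc i , 0) → p ≡ (i , 0) ⊎ p ≡ (suc i , 1) ⊎ p ≡ (suc (suc i) , 0)
  left-neighbours _ (inj₁ (refl , inj₂ refl)) = inj₂ (inj₁ refl)
  left-neighbours _ (inj₂ (inj₁ refl , refl)) = inj₁ refl
  left-neighbours _ (inj₂ (inj₂ refl , refl)) = inj₂ (inj₂ refl)

  corner-neighbours : ∀ p → Near p (0 , 0) → p ≡ (0 , 1) ⊎ p ≡ (1 , 0)
  corner-neighbours _ (inj₁ (refl , inj₂ refl)) = inj₁ refl
  corner-neighbours _ (inj₂ (inj₂ refl , refl)) = inj₂ refl

  Grid : ℕ → Graph
  Grid n = path n □ path n

  module _ {n : ℕ} where
    open Graph (Grid n) using (V; _∼_)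

    coordinates : V → ℕ × ℕ
    coordinates (i , j) = toℕ i , toℕ j

    coordinates-injective : ∀ {u v} → coordinates u ≡ coordinates v → u ≡ v
    coordinates-injective e = cong₂ _,_ (toℕ-injective (cong proj₁ e)) (toℕ-injective (cong proj₂ e))

    ∼⇒Near : ∀ {u v} → u ∼ v → Near (coordinates u) (coordinates v)
    ∼⇒Near (inj₁ (e , a)) = inj₁ (cong toℕ e , a)
    ∼⇒Near (inj₂ (a , e)) = inj₂ (a , cong toℕ e)

    Near⇒∼ : ∀ {u v} → Near (coordinates u) (coordinates v) → u ∼ v
    Near⇒∼ (inj₁ (e , a)) = inj₁ (toℕ-injective e , a)
    Near⇒∼ (inj₂ (a , e)) = inj₂ (a , toℕ-injective e)

    vertexAt : ∀ {i j} → i < n → j < n → ∃ λ (v : V) → coordinates v ≡ (i , j)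
    vertexAt i<n j<n = (fromℕ< i<n , fromℕ< j<n) , cong₂ _,_ (toℕ-fromℕ< i<n) (toℕ-fromℕ< j<n)

    opposite-consecutive : ∀ {i j : Fin n} → suc (toℕ i) ≡ toℕ j → suc (toℕ (opposite j)) ≡ toℕ (opposite i)
    opposite-consecutive {i} {j} e = begin
      suc (toℕ (opposite j))    ≡⟨ cong suc (opposite-prop j) ⟩
      suc (n ∸ suc (toℕ j))     ≡⟨ +-∸-assoc 1 (toℕ<n j) ⟨
      n ∸ toℕ j                 ≡⟨ cong (n ∸_) e ⟨
      n ∸ suc (toℕ i)           ≡⟨ opposite-prop i ⟨
      toℕ (opposite i)          ∎
      where open ≡-Reasoning

    opposite^-consecutive : ∀ p {i j : Fin n} → Consecutive (toℕ i) (toℕ j) →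
                            Consecutive (toℕ ((opposite ^ᵇ p) i)) (toℕ ((opposite ^ᵇ p) j))
    opposite^-consecutive false a        = a
    opposite^-consecutive true  (inj₁ e) = inj₂ (opposite-consecutive e)
    opposite^-consecutive true  (inj₂ e) = inj₁ (opposite-consecutive e)

    reflect-∼ : ∀ p {u v} → u ∼ v → reflect p u ∼ reflect p v
    reflect-∼ (p , q) (inj₁ (e , a)) = inj₁ (cong (opposite ^ᵇ p) e , opposite^-consecutive q a)
    reflect-∼ (p , q) (inj₂ (a , e)) = inj₂ (opposite^-consecutive p a , cong (opposite ^ᵇ q) e)

    move-∼ : ∀ g {u v} → u ∼ v → move g u ∼ move g v
    move-∼ (false , p) a = reflect-∼ p a
    move-∼ (true  , p) a with reflect-∼ p a
    ... | inj₁ (e , b) = inj₂ (b , e)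
    ... | inj₂ (b , e) = inj₁ (e , b)

    move-inverseˡ : ∀ g (v : V) → move (g ⁻¹) (move g v) ≡ v
    move-inverseˡ g v = trans (sym (move-∙ (g ⁻¹) g v)) (cong (λ h → move h v) (inverseˡ g))

    move-inverseʳ : ∀ g (v : V) → move g (move (g ⁻¹) v) ≡ v
    move-inverseʳ g v = trans (sym (move-∙ g (g ⁻¹) v)) (cong (λ h → move h v) (inverseʳ g))

    moveAutomorphism : Carrier → Automorphism (Grid n)
    moveAutomorphism g = record
      { bijection = mk↔ₛ′ (move g) (move (g ⁻¹)) (move-inverseʳ g) (move-inverseˡ g)
      ; preserves = λ u v → mk⇔ (move-∼ g) (λ a → subst₂ _∼_ (move-inverseˡ g u) (move-inverseˡ g v) (move-∼ (g ⁻¹) a))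
      }

  module _ {m : ℕ} where

    private
      n : ℕ
      n = suc (suc m)

    open Graph (Grid n) using (V; _∼_)

    -- Stated for injections preserving adjacency, so that it applies directly to an automorphism
    -- followed by a symmetry. The neighbour must be fixed too, because the transposition fixes the
    -- corner.
    module Rigid (f : V → V) (f-injective : ∀ {u v} → f u ≡ f v → u ≡ v) (f-∼ : ∀ {u v} → u ∼ v → f u ∼ f v)
                 (f-corner : f (zero , zero) ≡ (zero , zero)) (f-next : f (zero , suc zero) ≡ (zero , suc zero)) where

      -- Quantifying over vertices with given coordinates makes the claim vacuous outside the grid,
      -- so the induction carries no bounds.
      FixedAt : ℕ × ℕ → Set
      FixedAt p = ∀ (u : V) → coordinates u ≡ p → f u ≡ u

      -- A vertex at `p` has to be supplied, since `FixedAt p` says nothing where there is none.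
      image-near : ∀ {p q} {u : V} → FixedAt p → coordinates u ≡ q → (∃ λ (v : V) → coordinates v ≡ p) → Near q p →
                   Near (coordinates (f u)) p
      image-near {u = u} fixed refl (v , refl) near =
        subst (λ w → Near (coordinates (f u)) (coordinates w)) (fixed v refl) (∼⇒Near (f-∼ (Near⇒∼ near)))

      not-image : ∀ {p q} {u : V} → FixedAt p → coordinates u ≡ q → (∃ λ (v : V) → coordinates v ≡ p) → q ≢ p →
                  coordinates (f u) ≢ p
      not-image {u = u} fixed refl (v , refl) q≢p e =
        q≢p (cong coordinates (f-injective (trans (coordinates-injective e) (sym (fixed v refl)))))

      bounds : ∀ {i j} (u : V) → coordinates u ≡ (i , j) → i < n × j < n
      bounds (a , b) refl = toℕ<n a , toℕ<n b

      below : ∀ {k} → suc k < n → k < n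
      below = <-trans (n<1+n _)

      1<n : 1 < n
      1<n = s<s z<s

      fixed-inner : ∀ {i j} → FixedAt (i , j) → FixedAt (suc i , j) → FixedAt (i , suc j) → FixedAt (suc i , suc j)
      fixed-inner {i} {j} fᵢⱼ f₁ f₂ u e with i<n , j<n ← bounds u e
        with common-neighbours (coordinates (f u)) (image-near f₁ e (vertexAt i<n (below j<n)) (inj₁ (refl , inj₂ refl)))
                                                   (image-near f₂ e (vertexAt (below i<n) j<n) (inj₂ (inj₂ refl , refl)))
      ... | inj₁ e′ = contradiction e′ (not-image fᵢⱼ e (vertexAt (below i<n) (below j<n)) λ ())
      ... | inj₂ e′ = coordinates-injective (trans e′ (sym e))

      -- Two of the three possible neighbours of (0, j + 1) are taken by fixed vertices, so the
      -- third is left. One of the two, (1, j + 1), lies on the same antidiagonal as the new vertex;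
      -- hence inner vertices come first.
      fixed-top : ∀ {j} → FixedAt (0 , j) → FixedAt (0 , suc j) → FixedAt (1 , suc j) → FixedAt (0 , suc (suc j))
      fixed-top {j} f₀ f₁ f₂ u e with _ , j<n ← bounds u e
        with top-neighbours (coordinates (f u)) (image-near f₁ e (vertexAt z<s (below j<n)) (inj₁ (refl , inj₂ refl)))
      ... | inj₁ e′        = contradiction e′ (not-image f₀ e (vertexAt z<s (below (below j<n))) λ ())
      ... | inj₂ (inj₁ e′) = contradiction e′ (not-image f₂ e (vertexAt 1<n (below j<n)) λ ())
      ... | inj₂ (inj₂ e′) = coordinates-injective (trans e′ (sym e))

      fixed-left : ∀ {i} → FixedAt (i , 0) → FixedAt (suc i , 0) → FixedAt (suc i , 1) → FixedAt (suc (suc i) , 0)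
      fixed-left {i} f₀ f₁ f₂ u e with i<n , _ ← bounds u e
        with left-neighbours (coordinates (f u)) (image-near f₁ e (vertexAt (below i<n) z<s) (inj₂ (inj₂ refl , refl)))
      ... | inj₁ e′        = contradiction e′ (not-image f₀ e (vertexAt (below (below i<n)) z<s) λ ())
      ... | inj₂ (inj₁ e′) = contradiction e′ (not-image f₂ e (vertexAt (below i<n) 1<n) λ ())
      ... | inj₂ (inj₂ e′) = coordinates-injective (trans e′ (sym e))

      fixed-00 : FixedAt (0 , 0)
      fixed-00 u e = subst (λ v → f v ≡ v) (sym (coordinates-injective {v = zero , zero} e)) f-corner

      fixed-01 : FixedAt (0 , 1)
      fixed-01 u e = subst (λ v → f v ≡ v) (sym (coordinates-injective {v = zero , suc zero} e)) f-next

      -- Once (0, 1) is fixed, the corner has just this neighbour left.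
      fixed-10 : FixedAt (1 , 0)
      fixed-10 u e with corner-neighbours (coordinates (f u)) (image-near fixed-00 e (vertexAt z<s z<s) (inj₂ (inj₂ refl , refl)))
      ... | inj₁ e′ = contradiction e′ (not-image fixed-01 e (vertexAt z<s 1<n) λ ())
      ... | inj₂ e′ = coordinates-injective (trans e′ (sym e))

      FixedOn : ℕ → Set
      FixedOn s = ∀ i j → i + j ≡ s → FixedAt (i , j)

      -- Two consecutive antidiagonals are carried because a vertex is pinned down by vertices one
      -- and two antidiagonals back.
      fixed-diagonal : ∀ s → FixedOn s × FixedOn (suc s)
      fixed-diagonal zero = (λ { zero zero refl → fixed-00 }) , λ { zero (suc zero) refl → fixed-01 ; (suc zero) zero refl → fixed-10 }
      fixed-diagonal (suc s) with lower , upper ← fixed-diagonal s = upper , next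
        where
        inner : ∀ i j → i + j ≡ s → FixedAt (suc i , suc j)
        inner i j e = fixed-inner (lower i j e) (upper (suc i) j (cong suc e)) (upper i (suc j) (trans (+-suc i j) (cong suc e)))

        next : FixedOn (suc (suc s))
        next zero          (suc (suc j)) refl = fixed-top (lower 0 j refl) (upper 0 (suc j) refl) (inner 0 j refl)
        next (suc (suc i)) zero          e    = fixed-left (lower i 0 e′) (upper (suc i) 0 (cong suc e′)) (inner i 0 e′)
          where e′ = suc-injective (suc-injective e)
        next (suc i)       (suc j)       e    = inner i j (suc-injective (trans (sym (+-suc i j)) (suc-injective e)))

      identity : ∀ u → f u ≡ u
      identity u@(a , b) = proj₁ (fixed-diagonal (toℕ a + toℕ b)) (toℕ a) (toℕ b) refl u refl

    corner : V
    corner = zero , zero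

    module _ (α : Automorphism (Grid n)) where
      open Automorphism α

      to-∼ : ∀ {u v} → u ∼ v → to u ∼ to v
      to-∼ = Equivalence.to (preserves _ _)

      to-injective : ∀ {u v} → to u ≡ to v → u ≡ v
      to-injective {u} {v} e = trans (sym (strictlyInverseʳ u)) (trans (cong from e) (strictlyInverseʳ v))

      from-neighbour : ∀ {a} → a ∼ to corner → coordinates (from a) ≡ (0 , 1) ⊎ coordinates (from a) ≡ (1 , 0)
      from-neighbour {a} a∼ = corner-neighbours _
        (∼⇒Near (Equivalence.from (preserves _ _) (subst (_∼ to corner) (sym (strictlyInverseˡ a)) a∼)))

      from-coordinates-injective : ∀ {a b p} → coordinates (from a) ≡ p → coordinates (from b) ≡ p → a ≡ b
      from-coordinates-injective {a} {b} e e′ = trans (sym (strictlyInverseˡ a))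
        (trans (cong to (coordinates-injective (trans e (sym e′)))) (strictlyInverseˡ b))

      -- Pigeonhole: pulled back by the inverse, three distinct vertices would have to share the two
      -- neighbours of the corner.
      corner-degree : ∀ {a b c} → a ∼ to corner → b ∼ to corner → c ∼ to corner → a ≢ b → a ≢ c → b ≢ c → ∀ {X : Set} → X
      corner-degree a∼ b∼ c∼ a≢b a≢c b≢c with from-neighbour a∼ | from-neighbour b∼ | from-neighbour c∼
      ... | inj₁ p | inj₁ q | _      = contradiction (from-coordinates-injective p q) a≢b
      ... | inj₂ p | inj₂ q | _      = contradiction (from-coordinates-injective p q) a≢b
      ... | inj₁ p | inj₂ _ | inj₁ r = contradiction (from-coordinates-injective p r) a≢c
      ... | inj₂ p | inj₁ _ | inj₂ r = contradiction (from-coordinates-injective p r) a≢c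
      ... | inj₁ _ | inj₂ q | inj₂ r = contradiction (from-coordinates-injective q r) b≢c
      ... | inj₂ _ | inj₁ q | inj₁ r = contradiction (from-coordinates-injective q r) b≢c

    Neighbour : Fin n → Set
    Neighbour a = ∃ λ (a′ : Fin n) → Consecutive (toℕ a′) (toℕ a)

    Neighbour⇒≢ : ∀ {a : Fin n} ((a′ , _) : Neighbour a) → a′ ≢ a
    Neighbour⇒≢ (_ , inj₁ e) refl = contradiction e 1+n≢n
    Neighbour⇒≢ (_ , inj₂ e) refl = contradiction e 1+n≢n

    neighbour : ∀ a → Neighbour a
    neighbour zero    = suc zero , inj₂ refl
    neighbour (suc a) = inject₁ a , inj₁ (cong suc (toℕ-inject₁ a))

    -- An end of the path is written as a power of `opposite` applied to `zero`, ready to be a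
    -- component of a reflection.
    two-neighbours-or-end : ∀ a → (∃ λ ((a₁ , _) : Neighbour a) → ∃ λ ((a₂ , _) : Neighbour a) → a₁ ≢ a₂)
                                  ⊎ (∃ λ p → (opposite ^ᵇ p) zero ≡ a)
    two-neighbours-or-end zero    = inj₂ (false , refl)
    two-neighbours-or-end (suc a) with suc (suc (toℕ a)) <? n
    ... | yes a<n = inj₁ (neighbour (suc a) , (fromℕ< a<n , inj₂ (sym (toℕ-fromℕ< a<n))) ,
                          λ e → contradiction
                            (trans (sym (toℕ-inject₁ a)) (trans (cong toℕ e) (toℕ-fromℕ< a<n))) (<⇒≢ (m<n⇒m<1+n (n<1+n (toℕ a)))))
    ... | no a≮n  = inj₂ (true , toℕ-injective (trans (toℕ-fromℕ (suc m)) (suc-injective (≤-antisym (≮⇒≥ a≮n) (toℕ<n (suc a))))))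

    -- If a coordinate of the image were not an end of the path, its two neighbours and one in the
    -- other direction would give the image degree at least three.
    corner-image : ∀ α → ∃ λ p → reflect p corner ≡ Automorphism.to α corner
    corner-image α with two-neighbours-or-end (proj₁ w) | two-neighbours-or-end (proj₂ w)
      where w = Automorphism.to α corner
    ... | inj₂ (p , e) | inj₂ (q , e′) = (p , q) , cong₂ _,_ e e′
    ... | inj₁ ((_ , n₁) , (_ , n₂) , a₁≢a₂) | _ =
      let b = neighbour (proj₂ (Automorphism.to α corner)) in
      corner-degree α (inj₂ (n₁ , refl)) (inj₂ (n₂ , refl)) (inj₁ (refl , proj₂ b))
        (a₁≢a₂ ∘ cong proj₁) (Neighbour⇒≢ b ∘ sym ∘ cong proj₂) (Neighbour⇒≢ b ∘ sym ∘ cong proj₂)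
    ... | inj₂ _ | inj₁ ((_ , n₁) , (_ , n₂) , b₁≢b₂) =
      let a = neighbour (proj₁ (Automorphism.to α corner)) in
      corner-degree α (inj₁ (refl , n₁)) (inj₁ (refl , n₂)) (inj₂ (proj₂ a , refl))
        (b₁≢b₂ ∘ cong proj₂) (Neighbour⇒≢ a ∘ sym ∘ cong proj₁) (Neighbour⇒≢ a ∘ sym ∘ cong proj₁)

    module _ (α : Automorphism (Grid n)) where
      open Automorphism α using (to)

      -- By rigidity the automorphism followed by `g` is the identity, so it agrees with the inverse
      -- of `g`.
      straighten : ∀ g → move g (to corner) ≡ corner → move g (to (zero , suc zero)) ≡ (zero , suc zero) →
                   ∃ λ h → ∀ v → to v ≡ move h v
      straighten g e e′ = g ⁻¹ , λ v → trans (sym (move-inverseˡ g (to v))) (cong (move (g ⁻¹)) (Rigid.identity (move g ∘ to)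
        (λ {u} {v} eq → to-injective α (trans (sym (move-inverseˡ g (to u)))
          (trans (cong (move (g ⁻¹)) eq) (move-inverseˡ g (to v)))))
        (λ a → move-∼ g (to-∼ α a)) e e′ v))

      automorphism-is-move : ∃ λ g → ∀ v → to v ≡ move g v
      automorphism-is-move with p , e ← corner-image α = by-image-of-next (corner-neighbours (coordinates (reflect p (to next)))
        (subst (Near (coordinates (reflect p (to next)))) (cong coordinates at-corner) (∼⇒Near (reflect-∼ p (to-∼ α next∼corner)))))
        where
        next : V
        next = zero , suc zero

        next∼corner : next ∼ corner
        next∼corner = inj₁ (refl , inj₂ refl)

        at-corner : reflect p (to corner) ≡ corner
        -- `(false , p)` is its own inverse in `D₄`, so reflecting twice by `p` restores the corner.
        at-corner = trans (cong (reflect p) (sym e)) (move-inverseˡ (false , p) corner)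

        by-image-of-next : coordinates (reflect p (to next)) ≡ (0 , 1) ⊎ coordinates (reflect p (to next)) ≡ (1 , 0) →
                           ∃ λ g → ∀ v → to v ≡ move g v
        by-image-of-next (inj₁ e′) = straighten (false , p) at-corner (coordinates-injective e′)
        -- The transposition brings (1, 0) to (0, 1) and keeps the corner.
        by-image-of-next (inj₂ e′) = straighten (true , p) (cong swap at-corner)
          (cong swap (coordinates-injective {v = suc zero , zero} e′))

    -- The corner is moved by every nontrivial element but the transposition, which moves the
    -- neighbour of the corner.
    move-faithful : ∀ g → (∀ (v : V) → move g v ≡ v) → g ≡ ε
    move-faithful (false , false , false) _ = refl
    move-faithful (true  , false , false) fix with () ← fix (zero , suc zero)
    move-faithful (false , true  , _)     fix with () ← fix corner
    move-faithful (false , false , true)  fix with () ← fix corner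
    move-faithful (true  , true  , _)     fix with () ← fix corner
    move-faithful (true  , false , true)  fix with () ← fix corner

-- Classes of distinguishing colourings as free orbits

module Classification where
  open import Defs
  open Counting
  open Coding
  open Actions
  open SquareSymmetries
  open FreeColourings
  open GridAutomorphisms
  open import Data.Nat using (ℕ; suc; _*_; _^_)
  open import Data.Fin.Base using (Fin)
  open import Data.Product.Base using (Σ; ∃; _,_)
  open import Function.Base using (_∘_)
  open import Function.Bundles using (_⇔_; mk⇔; Equivalence)
  open import Relation.Binary.Bundles using (Setoid)
  open import Relation.Binary.PropositionalEquality

  module _ (m k : ℕ) where
    private
      n : ℕ
      n = suc (suc m)

      G : Graph
      G = Grid n

      V : Set
      V = Graph.V G

    open Setoid (DistinguishingColorings G k) using () renaming (_≈_ to _≈ᶜ_; refl to ≈ᶜ-refl; sym to ≈ᶜ-sym; trans to ≈ᶜ-trans)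

    encode : (V → Fin k) → Fin (k ^ (n * n))
    encode c = code (c ∘ vertex n)

    decode : Fin (k ^ (n * n)) → V → Fin k
    decode x = colour {k} {n * n} x ∘ index n

    encode-decode : ∀ x → encode (decode x) ≡ x
    encode-decode x = colour-injective k (n * n) (λ i →
      trans (colour-code (decode x ∘ vertex n) i) (cong (colour {k} {n * n} x) (index-vertex n i)))

    -- The dictionary between codes and colourings: with `d` equal to `c` it matches fixed codes
    -- with colour-preserving symmetries, in general it matches orbits with equivalence.
    act-encode⇔ : ∀ g c d → act n k g (encode c) ≡ encode d ⇔ (∀ v → c v ≡ d (move g v))
    act-encode⇔ g c d = mk⇔
      (λ e v → begin
        c v                                                            ≡⟨ cong c (vertex-index n v) ⟨
        c (vertex n (index n v))
          ≡⟨ colour-code (c ∘ vertex n) (index n v) ⟨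
        colour (encode c) (index n v)                                  ≡⟨ Equivalence.to moved e (index n v) ⟨
        colour (encode d) (index n (move g (vertex n (index n v))))
          ≡⟨ colour-code (d ∘ vertex n) (index n (move g (vertex n (index n v)))) ⟩
        d (vertex n (index n (move g (vertex n (index n v)))))
          ≡⟨ cong d (vertex-index n (move g (vertex n (index n v)))) ⟩
        d (move g (vertex n (index n v)))                              ≡⟨ cong (d ∘ move g) (vertex-index n v) ⟩
        d (move g v)                                                   ∎)
      (λ e → Equivalence.from moved (λ i → begin
        colour (encode d) (index n (move g (vertex n i)))
          ≡⟨ colour-code (d ∘ vertex n) (index n (move g (vertex n i))) ⟩
        d (vertex n (index n (move g (vertex n i))))
          ≡⟨ cong d (vertex-index n (move g (vertex n i))) ⟩
        d (move g (vertex n i))                                        ≡⟨ e (vertex n i) ⟨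
        c (vertex n i)                                                 ≡⟨ colour-code (c ∘ vertex n) i ⟨
        colour (encode c) i                                            ∎))
      where
      open ≡-Reasoning
      moved = act≡⇔ (squareAction n) k g (encode c) (encode d)

    Distinguishing⇒Free : ∀ {c} → Distinguishing G c → Free n k (encode c)
    Distinguishing⇒Free {c} dist g e = move-faithful g
      (dist (moveAutomorphism g) (λ v → sym (Equivalence.to (act-encode⇔ g c c) e v)))

    -- Here the classification enters: a trivial stabilizer in `D₄` has to rule out every
    -- automorphism of the grid.
    Free⇒Distinguishing : ∀ {c} → Free n k (encode c) → Distinguishing G c
    Free⇒Distinguishing {c} free α e v = let g , α≗g = automorphism-is-move α in
      trans (α≗g v) (cong (λ h → move h v) (free g (Equivalence.from (act-encode⇔ g c c)
        (λ u → trans (sym (e u)) (cong c (α≗g u))))))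

    Equivalent⇒orbit : ∀ {c d} → Equivalent G c d → ∃ λ g → act n k g (encode c) ≡ encode d
    Equivalent⇒orbit {c} {d} (α , e) = let g , α≗g = automorphism-is-move α in
      g , Equivalence.from (act-encode⇔ g c d) (λ v → trans (e v) (cong d (α≗g v)))

    orbit⇒Equivalent : ∀ {c d} g → act n k g (encode c) ≡ encode d → Equivalent G c d
    orbit⇒Equivalent {c} {d} g e = moveAutomorphism g , Equivalence.to (act-encode⇔ g c d) e

    class : Σ (Coloring G k) (Distinguishing G) → Fin (freeOrbits n k)
    class (c , dist) = freeOrbit n k (encode c) (Distinguishing⇒Free {c} dist)

    classColoring : Fin (freeOrbits n k) → Σ (Coloring G k) (Distinguishing G)
    classColoring j = c , Free⇒Distinguishing {c}
      (subst (Free n k) (sym (encode-decode (representative n k j))) (representative-free n k j))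
      where
      c : Coloring G k
      c = decode (representative n k j)

    -- Both halves of the bijection rest on this: it is one inverse law and, with `≈-classColoring`,
    -- it gives the invariance of `class`.
    class-unique : ∀ j x → x ≈ᶜ classColoring j → class x ≡ j
    class-unique j (c , dist) c≈j = in-orbit (Equivalent⇒orbit {c} {decode (representative n k j)} c≈j)
      where
      in-orbit : (∃ λ g → act n k g (encode c) ≡ encode (decode (representative n k j))) → class (c , dist) ≡ j
      in-orbit (g , e) = freeOrbit-unique n k j (encode c) (Distinguishing⇒Free {c} dist) g
        (trans e (encode-decode (representative n k j)))

    ≈-classColoring : ∀ x → x ≈ᶜ classColoring (class x)
    ≈-classColoring (c , dist) = orbit⇒Equivalent {c} {decode (representative n k (class (c , dist)))} (minimizer n k (encode c))
      (trans (representative-freeOrbit n k (encode c) (Distinguishing⇒Free {c} dist))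
             (sym (encode-decode (representative n k (class (c , dist))))))

    freeOrbits-IsΦ : IsΦ k G (freeOrbits n k)
    freeOrbits-IsΦ = record
      { to        = class
      ; from      = classColoring
      ; to-cong   = λ {x} {y} x≈y → class-unique (class y) x (≈ᶜ-trans {x} {y} {classColoring (class y)} x≈y (≈-classColoring y))
      ; from-cong = λ { {i} refl → ≈ᶜ-refl {classColoring i} }
      ; inverse   = (λ {j} {x} → class-unique j x) , λ { {x} refl → ≈ᶜ-sym {x} {classColoring (class x)} (≈-classColoring x) }
      }

-- From natural numbers to the rational formula

module Rationalisation where
  open import Data.Integer using (ℤ; +_; -_; _+_; _-_; _*_; _^_)
  open import Data.Integer.Properties using (pos-*; *-identityʳ)
  open import Data.Integer.Tactic.RingSolver using (solve-∀)
  open import Data.Nat using (ℕ; zero; suc) renaming (_+_ to _+ⁿ_; _*_ to _*ⁿ_; _^_ to _^ⁿ_)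
  open import Data.Rational using (_/_)
  open import Data.Rational.Properties using (fromℚᵘ-cong)
  open import Data.Rational.Unnormalised using (mkℚᵘ; *≡*)
  open import Relation.Binary.PropositionalEquality
  open ≡-Reasoning

  pos-^ : ∀ k e → + (k ^ⁿ e) ≡ (+ k) ^ e
  pos-^ k zero    = refl
  pos-^ k (suc e) = trans (pos-* k (k ^ⁿ e)) (cong (+ k *_) (pos-^ k e))

  divide-by-8 : ∀ Φ x → + 8 * + Φ ≡ x → + Φ / 1 ≡ x / 8
  -- `mkℚᵘ` stores the denominator minus one, so 0 and 7 stand for 1 and 8.
  divide-by-8 Φ x e = fromℚᵘ-cong {mkℚᵘ (+ Φ) 0} {mkℚᵘ x 7} (*≡* (begin
    + Φ * + 8  ≡⟨ commute (+ Φ) ⟩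
    + 8 * + Φ  ≡⟨ e ⟩
    x          ≡⟨ *-identityʳ x ⟨
    x * + 1    ∎))
    where
    commute : ∀ y → y * + 8 ≡ + 8 * y
    commute = solve-∀

  subtract : ∀ φ t r b c e f → + 8 * φ + (r + b + b + c + c) ≡ t + (+ 2 * e + + 2 * f) →
             + 8 * φ ≡ t - r - + 2 * b - + 2 * c + + 2 * e + + 2 * f
  subtract φ t r b c e f eq = begin
    + 8 * φ                                                        ≡⟨ add-subtract (+ 8 * φ) r b c ⟩
    + 8 * φ + (r + b + b + c + c) - (r + b + b + c + c)            ≡⟨ cong (_- (r + b + b + c + c)) eq ⟩
    t + (+ 2 * e + + 2 * f) - (r + b + b + c + c)                  ≡⟨ rearrange t r b c e f ⟩
    t - r - + 2 * b - + 2 * c + + 2 * e + + 2 * f                  ∎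
    where
    add-subtract : ∀ x r b c → x ≡ x + (r + b + b + c + c) - (r + b + b + c + c)
    add-subtract = solve-∀
    rearrange : ∀ t r b c e f → t + (+ 2 * e + + 2 * f) - (r + b + b + c + c) ≡ t - r - + 2 * b - + 2 * c + + 2 * e + + 2 * f
    rearrange = solve-∀

  eighth : ∀ k Φ t r b c e f →
           8 *ⁿ Φ +ⁿ (k ^ⁿ r +ⁿ k ^ⁿ b +ⁿ k ^ⁿ b +ⁿ k ^ⁿ c +ⁿ k ^ⁿ c) ≡ k ^ⁿ t +ⁿ (2 *ⁿ k ^ⁿ e +ⁿ 2 *ⁿ k ^ⁿ f) →
           + Φ / 1 ≡ ((+ k) ^ t - (+ k) ^ r - + 2 * (+ k) ^ b - + 2 * (+ k) ^ c + + 2 * (+ k) ^ e + + 2 * (+ k) ^ f) / 8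
  eighth k Φ t r b c e f eq = divide-by-8 Φ _ (subtract (+ Φ) (K t) (K r) (K b) (K c) (K e) (K f) (begin
    + 8 * + Φ + (K r + K b + K b + K c + K c)
      ≡⟨ cong₂ _+_ (pos-* 8 Φ) pos-sum ⟨
    + (8 *ⁿ Φ) + + (k ^ⁿ r +ⁿ k ^ⁿ b +ⁿ k ^ⁿ b +ⁿ k ^ⁿ c +ⁿ k ^ⁿ c)
      ≡⟨ cong +_ eq ⟩
    + (k ^ⁿ t +ⁿ (2 *ⁿ k ^ⁿ e +ⁿ 2 *ⁿ k ^ⁿ f))
      ≡⟨ cong₂ _+_ (pos-^ k t) (cong₂ _+_ (pos-double e) (pos-double f)) ⟩
    K t + (+ 2 * K e + + 2 * K f) ∎))
    where
    K : ℕ → ℤ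
    K i = (+ k) ^ i

    pos-sum : + (k ^ⁿ r +ⁿ k ^ⁿ b +ⁿ k ^ⁿ b +ⁿ k ^ⁿ c +ⁿ k ^ⁿ c) ≡ K r + K b + K b + K c + K c
    pos-sum = cong₂ _+_ (cong₂ _+_ (cong₂ _+_ (cong₂ _+_ (pos-^ k r) (pos-^ k b)) (pos-^ k b)) (pos-^ k c)) (pos-^ k c)

    pos-double : ∀ i → + (2 *ⁿ k ^ⁿ i) ≡ + 2 * K i
    pos-double i = trans (pos-* 2 (k ^ⁿ i)) (cong (+ 2 *_) (pos-^ k i))

open import Defs
open import Data.Nat using (ℕ; _≥_; ⌈_/2⌉)
open import Data.Nat using () renaming (_+_ to _+ⁿ_; _*_ to _*ⁿ_; _^_ to _^ⁿ_; _/_ to _/ⁿ_)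
open import Data.Integer using (ℤ; +_; _+_; _-_; _*_; _^_)
open import Data.Rational using (ℚ; _/_)
open import Data.Product using (∃-syntax; _×_)
open import Relation.Binary.PropositionalEquality using (_≡_)
open import Data.Nat using (s≤s)
open import Data.Product using (_,_)
open FreeColourings using (freeOrbits; 8*freeOrbits)
open Classification using (freeOrbits-IsΦ)
open Rationalisation using (eighth)

theorem5p2 : ∀ (n k : ℕ) → n ≥ 3 → k ≥ 2 →
    ∃[ Φ ] (IsΦ k (path n □ path n) Φ ×
    (+ Φ) / 1 ≡
    ( (+ k) ^ (n ^ⁿ 2)
    - (+ k) ^ ⌈ n ^ⁿ 2 /2⌉
    - (+ 2) * (+ k) ^ (n *ⁿ ⌈ n /2⌉)
    - (+ 2) * (+ k) ^ ((n *ⁿ (n +ⁿ 1)) /ⁿ 2)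
    + (+ 2) * (+ k) ^ (⌈ n /2⌉ ^ⁿ 2)
    + (+ 2) * (+ k) ^ (⌈ n /2⌉ *ⁿ ⌈ n +ⁿ 1 /2⌉)
    ) / 8)
-- Matching on the bound exposes `n` as `suc (suc m)`, where the corner and its neighbour are
-- constructor terms.
theorem5p2 n k (s≤s (s≤s {n = m} _)) _ = freeOrbits n k , freeOrbits-IsΦ m k ,
  eighth k (freeOrbits n k) (n ^ⁿ 2) ⌈ n ^ⁿ 2 /2⌉ (n *ⁿ ⌈ n /2⌉) ((n *ⁿ (n +ⁿ 1)) /ⁿ 2) (⌈ n /2⌉ ^ⁿ 2) (⌈ n /2⌉ *ⁿ ⌈ n +ⁿ 1 /2⌉) (8*freeOrbits n k)
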